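{- There exist infinitely many families $\mathcal{F}$ of graphs with $|\mathcal{F}| = 3$ such that the ratio $\frac{\mathrm{sat}(n,\mathcal{F})}{n}$ does not converge as $n \to \infty$.
   Context: For a family of graphs $\mathcal{F}$, a graph $G$ is $\mathcal{F}$-saturated if $G$ contains no copy (subgraph isomorphic to) of any graph in $\mathcal{F}$, but adding any edge to $G$ creates a copy of some graph in $\mathcal{F}$. $\mathrm{sat}(n,\mathcal{F})$ is the minimum number of edges in an $n$-vertex $\mathcal{F}$-saturated graph. -}

module Defs where

open import Data.Nat using (ℕ; zero; suc; _≤_)
open import Data.Bool using (Bool; true; false; _∧_; _∨_)
open import Data.Fin using (Fin; toℕ)
import Data.Fin as Fin
open import Data.Fin.Properties using (_≟_)
open import Data.Nat.Properties using (_<?_)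
open import Data.List using (List; length; filterᵇ; cartesianProduct; allFin)
open import Data.Product using (Σ; ∃; ∃-syntax; _×_; _,_; proj₁; proj₂)
open import Relation.Nullary using (¬_)
open import Relation.Nullary.Decidable using (⌊_⌋)
open import Relation.Binary.PropositionalEquality using (_≡_; _≢_)
open import Function.Definitions using (Injective)
open import Data.Integer using (+_)
open import Data.Rational using (ℚ; 0ℚ; _<_; _-_; ∣_∣; _/_)

record Graph (n : ℕ) : Set where
  field
    adj    : Fin n → Fin n → Bool
    sym    : ∀ i j → adj i j ≡ adj j i
    irrefl : ∀ i → adj i i ≡ false
open Graph public

AnyGraph : Set
AnyGraph = Σ ℕ Graph

edges : ∀ {n} → Graph n → ℕ
edges {n} G = length (filterᵇ (λ p → adj G (proj₁ p) (proj₂ p) ∧ ⌊ toℕ (proj₁ p) <? toℕ (proj₂ p) ⌋)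
                             (cartesianProduct (allFin n) (allFin n)))

_⊑_ : ∀ {m n} → Graph m → Graph n → Set
_⊑_ {m} {n} H G = Σ (Fin m → Fin n) λ f → Injective _≡_ _≡_ f × (∀ i j → adj H i j ≡ true → adj G (f i) (f j) ≡ true)

_≅_ : ∀ {m n} → Graph m → Graph n → Set
_≅_ {m} {n} G H = Σ (Fin m → Fin n) λ f → Σ (Fin n → Fin m) λ g →
  (∀ i → g (f i) ≡ i) × (∀ j → f (g j) ≡ j) × (∀ i j → adj G i j ≡ adj H (f i) (f j))

_≅'_ : AnyGraph → AnyGraph → Set
(_ , G) ≅' (_ , H) = G ≅ H

addEdge : ∀ {n} (G : Graph n) (u v : Fin n) → u ≢ v → Graph n
addEdge {n} G u v u≢v = record { adj = a ; sym = s ; irrefl = r }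
  where
  e : Fin n → Fin n → Bool
  e i j = (⌊ i ≟ u ⌋ ∧ ⌊ j ≟ v ⌋) ∨ (⌊ i ≟ v ⌋ ∧ ⌊ j ≟ u ⌋)
  a : Fin n → Fin n → Bool
  a i j = adj G i j ∨ e i j
  open import Relation.Nullary using (yes; no)
  open import Relation.Binary.PropositionalEquality using (refl; cong₂; trans)
  open import Data.Bool.Properties using (∨-comm)
  e-sym : ∀ i j → e i j ≡ e j i
  e-sym i j with i ≟ u | j ≟ v | i ≟ v | j ≟ u
  ... | yes _ | yes _ | yes _ | yes _ = refl
  ... | yes _ | yes _ | yes _ | no _ = refl
  ... | yes _ | yes _ | no _ | yes _ = refl
  ... | yes _ | yes _ | no _ | no _ = refl
  ... | yes _ | no _ | yes _ | yes _ = refl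
  ... | yes _ | no _ | yes _ | no _ = refl
  ... | yes _ | no _ | no _ | yes _ = refl
  ... | yes _ | no _ | no _ | no _ = refl
  ... | no _ | yes _ | yes _ | yes _ = refl
  ... | no _ | yes _ | yes _ | no _ = refl
  ... | no _ | yes _ | no _ | yes _ = refl
  ... | no _ | yes _ | no _ | no _ = refl
  ... | no _ | no _ | yes _ | yes _ = refl
  ... | no _ | no _ | yes _ | no _ = refl
  ... | no _ | no _ | no _ | yes _ = refl
  ... | no _ | no _ | no _ | no _ = refl
  s : ∀ i j → a i j ≡ a j i
  s i j = cong₂ _∨_ (sym G i j) (e-sym i j)
  open import Data.Empty using (⊥-elim)
  open import Relation.Binary.PropositionalEquality using (sym) renaming (trans to tr)
  r : ∀ i → a i i ≡ false
  r i with irrefl G i | i ≟ u | i ≟ v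
  ... | p | yes x | yes y = ⊥-elim (u≢v (tr (Relation.Binary.PropositionalEquality.sym x) y))
  ... | p | yes _ | no _ = tr (cong₂ _∨_ p refl) refl
  ... | p | no _ | yes _ = tr (cong₂ _∨_ p refl) refl
  ... | p | no _ | no _ = tr (cong₂ _∨_ p refl) refl

Family3 : Set
Family3 = Fin 3 → AnyGraph

IsFamilyOfSize3 : Family3 → Set
IsFamilyOfSize3 F = ∀ i j → i ≢ j → ¬ (F i ≅' F j)

SameFamily : Family3 → Family3 → Set
SameFamily F F' = (∀ i → ∃[ j ] (F i ≅' F' j)) × (∀ j → ∃[ i ] (F' j ≅' F i))

ContainsMember : ∀ {n} → Family3 → Graph n → Set
ContainsMember F G = ∃[ i ] (proj₂ (F i) ⊑ G)

Saturated : ∀ {n} → Family3 → Graph n → Set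
Saturated F G = ¬ ContainsMember F G ×
  (∀ u v → (u≢v : u ≢ v) → adj G u v ≡ false → ContainsMember F (addEdge G u v u≢v))

IsSat : ℕ → Family3 → ℕ → Set
IsSat n F s = (∃[ G ] (Saturated {n} F G × edges G ≡ s)) × (∀ (G : Graph n) → Saturated F G → s ≤ edges G)

-- Convergence of a rational sequence (to a real limit), expressed as the
-- Cauchy property, since the standard library has no real numbers.
Converges : (ℕ → ℚ) → Set
Converges a = ∀ (ε : ℚ) → 0ℚ < ε → ∃[ N ] (∀ m k → N ≤ m → N ≤ k → ∣ a m - a k ∣ < ε)

-- The ratio s(n)/n, indexed from n = 1.
ratio : (ℕ → ℕ) → ℕ → ℚ
ratio s n = (+ s (suc n)) / suc n

{-# OPTIONS --safe #-}
module Submission where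

-- Forbid two K₄ sharing a vertex, two K₄ joined by an edge, and a K₄ with a further vertex attached to
-- two of its vertices. In a graph free of these, distinct K₄ are disjoint and non-adjacent.
-- If 4 divides n, disjoint K₄ form a saturated graph with 3n/2 edges. If n is odd, some vertex z of a
-- saturated graph lies in no K₄, since otherwise the graph would be cubic. Then no K₄ is a component, as
-- joining it to z would create nothing forbidden; so the set A of vertices in a K₄ sends at least |A|/4
-- edges to the rest S. Two non-adjacent vertices of S have two common neighbours, so either all vertices
-- of S have degree at least 4, or the at most three neighbours of a single vertex receive about 2|S|
-- edges from S. Together these give at least 14n/9 - O(1) edges.
-- Isolated vertices added to one member do not matter for large n, which yields infinitely many families.

open import Defs
open import Data.Bool using (Bool; true; false; _∧_; _∨_; not)
open import Data.Bool.Properties using (∧-zeroʳ; ∧-identityʳ; ∨-zeroʳ; ∨-comm; ¬-not) renaming (_≟_ to _≟ᵇ_)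
open import Data.Empty using (⊥-elim)
open import Data.Fin using (Fin; zero; suc; toℕ; combine; quotient; remainder; _↑ˡ_)
open import Data.Fin.Patterns
open import Data.Fin.Properties using (_≟_; any?; all?; injective⇒≤; ¬∀⟶∃¬; toℕ-injective; suc-injective; pigeonhole; combine-remQuot; remQuot-combine; combine-injectiveʳ; ↑ˡ-injective; <⇒≢)
import Data.Integer as ℤ
import Data.Integer.Properties as ℤ
open import Data.List using (List; []; _∷_; _++_; map; filterᵇ; length; cartesianProduct; allFin; tabulate)
open import Data.List.Membership.Propositional using (_∈_)
import Data.List.Membership.DecPropositional as DecMembership
open import Data.List.Membership.Propositional.Properties using (∈-cartesianProduct⁺; ∈-allFin)
open import Data.List.Properties using (filter-++; length-++; map-tabulate)
open import Data.List.Relation.Unary.All using (All; []; _∷_) renaming (lookup to All-lookup)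
open import Data.List.Relation.Unary.Any using (here; there)
open import Data.Nat using (ℕ; zero; suc; _+_; _*_; _≤_; _<_; z≤n; s≤s)
import Data.Nat.Properties as ℕ
open import Data.Nat.Tactic.RingSolver using (solve-∀)
open import Data.Product using (Σ; ∃; ∃₂; ∃-syntax; _×_; _,_; proj₁; proj₂)
open import Data.Product.Properties using (≡-dec)
open import Data.Rational using (0ℚ)
import Data.Rational as ℚ
import Data.Rational.Properties as ℚ
open import Data.Rational.Unnormalised using (mkℚᵘ; *≤*)
import Data.Rational.Unnormalised.Properties as ℚᵘ
open import Data.Sum using (_⊎_; inj₁; inj₂)
open import Data.Vec using (Vec; []; _∷_; lookup)
open import Data.Vec.Relation.Unary.All using ([]; _∷_)
open import Data.Vec.Relation.Unary.AllPairs using ([]; _∷_)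
open import Data.Vec.Relation.Unary.Unique.Propositional using (Unique)
open import Data.Vec.Relation.Unary.Unique.Propositional.Properties using (lookup-injective)
open import Function using (_∘_; id)
open import Function.Definitions using (Injective)
open import Relation.Binary.PropositionalEquality using (_≡_; _≢_; refl; trans; cong; cong₂; subst; subst₂; ≢-sym; module ≡-Reasoning) renaming (sym to ≡-sym)
open import Relation.Nullary using (¬_; Dec; yes; no)
open import Relation.Nullary.Decidable using (⌊_⌋; T?; from-yes; map′; ¬?; _×-dec_; _⊎-dec_; _→-dec_)
open import Algebra.Properties.Semiring.Sum ℕ.+-*-semiring using (sum; sum-syntax; sum-cong-≗; ∑-distrib-+; ∑-comm; *-distribˡ-sum; *-distribʳ-sum)

-- Sums and degrees

⟦_⟧ : Bool → ℕ
⟦ true ⟧  = 1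
⟦ false ⟧ = 0

⟦⟧≤1 : ∀ b → ⟦ b ⟧ ≤ 1
⟦⟧≤1 true  = s≤s z≤n
⟦⟧≤1 false = z≤n

∑-mono-≤ : ∀ {n} {f g : Fin n → ℕ} → (∀ i → f i ≤ g i) → sum f ≤ sum g
∑-mono-≤ {zero}  f≤g = z≤n
∑-mono-≤ {suc n} f≤g = ℕ.+-mono-≤ (f≤g zero) (∑-mono-≤ (f≤g ∘ suc))

∑-const : ∀ n c → ∑[ i < n ] c ≡ n * c
∑-const zero    c = refl
∑-const (suc n) c = cong (c +_) (∑-const n c)

term≤∑ : ∀ {n} (f : Fin n → ℕ) i → f i ≤ sum f
term≤∑ f zero    = ℕ.m≤m+n _ _
term≤∑ f (suc i) = ℕ.≤-trans (term≤∑ (f ∘ suc) i) (ℕ.m≤n+m _ _)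

∑-indicator : ∀ {n} (u : Fin n) → ∑[ v < n ] ⟦ ⌊ u ≟ v ⌋ ⟧ ≡ 1
∑-indicator {suc n} zero    = cong suc (trans (∑-const n 0) (ℕ.*-zeroʳ n))
∑-indicator {suc n} (suc u) = trans (sum-cong-≗ shift) (∑-indicator u)
  where
  shift : ∀ v → ⟦ ⌊ suc u ≟ suc v ⌋ ⟧ ≡ ⟦ ⌊ u ≟ v ⌋ ⟧
  shift v with u ≟ v
  ... | yes _ = refl
  ... | no _  = refl

∑∑ : ∀ {n} → (Fin n → Fin n → ℕ) → ℕ
∑∑ {n} f = ∑[ v < n ] ∑[ w < n ] f v w

∑∑-mono-≤ : ∀ {n} {f g : Fin n → Fin n → ℕ} → (∀ v w → f v w ≤ g v w) → ∑∑ f ≤ ∑∑ g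
∑∑-mono-≤ f≤g = ∑-mono-≤ λ v → ∑-mono-≤ (f≤g v)

∑∑-distrib-+ : ∀ {n} (f g : Fin n → Fin n → ℕ) → ∑∑ (λ v w → f v w + g v w) ≡ ∑∑ f + ∑∑ g
∑∑-distrib-+ f g = trans (sum-cong-≗ λ v → ∑-distrib-+ (f v) (g v)) (∑-distrib-+ (λ v → sum (f v)) (λ v → sum (g v)))

∑∑-transpose : ∀ {n} (f : Fin n → Fin n → ℕ) → ∑∑ (λ v w → f w v) ≡ ∑∑ f
∑∑-transpose f = ≡-sym (∑-comm f)

private
  length-filterᵇ : ∀ {A : Set} (p : A → Bool) x xs →
    length (filterᵇ p (x ∷ xs)) ≡ ⟦ p x ⟧ + length (filterᵇ p xs)
  length-filterᵇ p x xs with p x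
  ... | true  = refl
  ... | false = refl

  length-filter-tabulate : ∀ {A : Set} (p : A → Bool) {n} (f : Fin n → A) →
    length (filterᵇ p (tabulate f)) ≡ ∑[ i < n ] ⟦ p (f i) ⟧
  length-filter-tabulate p {zero}  f = refl
  length-filter-tabulate p {suc n} f = trans (length-filterᵇ p (f zero) (tabulate (f ∘ suc)))
    (cong (⟦ p (f zero) ⟧ +_) (length-filter-tabulate p (f ∘ suc)))

  length-filter-product : ∀ {A B : Set} (p : A × B → Bool) {m n} (f : Fin m → A) (g : Fin n → B) →
    length (filterᵇ p (cartesianProduct (tabulate f) (tabulate g))) ≡ ∑[ i < m ] ∑[ j < n ] ⟦ p (f i , g j) ⟧
  length-filter-product p {zero}  f g = refl
  length-filter-product p {suc m} {n} f g = begin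
    length (filterᵇ p (row ++ rest))                 ≡⟨ cong length (filter-++ (T? ∘ p) row rest) ⟩
    length (filterᵇ p row ++ filterᵇ p rest)         ≡⟨ length-++ (filterᵇ p row) ⟩
    length (filterᵇ p row) + length (filterᵇ p rest) ≡⟨ cong₂ _+_ rowCount (length-filter-product p (f ∘ suc) g) ⟩
    ∑[ i < suc m ] ∑[ j < n ] ⟦ p (f i , g j) ⟧      ∎
    where
    open ≡-Reasoning
    row = map (f zero ,_) (tabulate g)
    rest = cartesianProduct (tabulate (f ∘ suc)) (tabulate g)
    rowCount : length (filterᵇ p row) ≡ ∑[ j < n ] ⟦ p (f zero , g j) ⟧
    rowCount = trans (cong (length ∘ filterᵇ p) (map-tabulate g (f zero ,_)))
                     (length-filter-tabulate p (λ j → f zero , g j))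

adjℕ : ∀ {n} → Graph n → Fin n → Fin n → ℕ
adjℕ G u v = ⟦ adj G u v ⟧

degree : ∀ {n} → Graph n → Fin n → ℕ
degree {n} G u = ∑[ v < n ] adjℕ G u v

-- `edges` counts adjacent pairs in increasing order only. The decreasing pairs are their
-- transposes, and the diagonal contributes nothing.
handshake : ∀ {n} (G : Graph n) → sum (degree G) ≡ edges G + edges G
handshake {n} G = begin
  ∑[ i < n ] ∑[ j < n ] adjℕ G i j
    ≡⟨ sum-cong-≗ (λ i → sum-cong-≗ (λ j → split i j)) ⟩
  ∑[ i < n ] ∑[ j < n ] (up i j + up j i)
    ≡⟨ sum-cong-≗ (λ i → ∑-distrib-+ (up i) (λ j → up j i)) ⟩
  ∑[ i < n ] (∑[ j < n ] up i j + ∑[ j < n ] up j i)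
    ≡⟨ ∑-distrib-+ (λ i → ∑[ j < n ] up i j) (λ i → ∑[ j < n ] up j i) ⟩
  ∑[ i < n ] (∑[ j < n ] up i j) + ∑[ i < n ] (∑[ j < n ] up j i)
    ≡⟨ cong (∑[ i < n ] (∑[ j < n ] up i j) +_) (≡-sym (∑-comm up)) ⟩
  ∑[ i < n ] (∑[ j < n ] up i j) + ∑[ i < n ] (∑[ j < n ] up i j)
    ≡⟨ cong₂ _+_ count count ⟨
  edges G + edges G ∎
  where
  open ≡-Reasoning
  upᵇ : Fin n × Fin n → Bool
  upᵇ p = adj G (proj₁ p) (proj₂ p) ∧ ⌊ toℕ (proj₁ p) ℕ.<? toℕ (proj₂ p) ⌋
  up : Fin n → Fin n → ℕ
  up i j = ⟦ upᵇ (i , j) ⟧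
  count : edges G ≡ ∑[ i < n ] (∑[ j < n ] up i j)
  count = length-filter-product upᵇ id id
  split : ∀ i j → adjℕ G i j ≡ up i j + up j i
  split i j rewrite sym G j i with toℕ i ℕ.<? toℕ j | toℕ j ℕ.<? toℕ i
  ... | yes p | yes q = ⊥-elim (ℕ.<-asym p q)
  ... | yes p | no q rewrite ∧-zeroʳ (adj G i j) | ∧-identityʳ (adj G i j) = ≡-sym (ℕ.+-identityʳ _)
  ... | no p | yes q rewrite ∧-zeroʳ (adj G i j) | ∧-identityʳ (adj G i j) = refl
  ... | no p | no q with toℕ-injective (ℕ.≤-antisym (ℕ.≮⇒≥ q) (ℕ.≮⇒≥ p))
  ...   | refl rewrite irrefl G i = refl

-- Exhaustive search

-- Predicates must respect `_≈_` because functions, and hence graphs, are compared only pointwise: a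
-- search meets one representative of each class.
Searchable : {A : Set} → (A → A → Set) → Set₁
Searchable {A} _≈_ = (P : A → Set) → (∀ {x y} → x ≈ y → P x → P y) → (∀ x → Dec (P x)) → Dec (∃ P)

Fin-searchable : ∀ {n} → Searchable {Fin n} _≡_
Fin-searchable P _ P? = any? P?

Bool-searchable : Searchable {Bool} _≡_
Bool-searchable P _ P? with P? true | P? false
... | yes p | _     = yes (true , p)
... | no _  | yes q = yes (false , q)
... | no p  | no q  = no λ { (true , r) → p r ; (false , r) → q r }

infixr 5 _◂_
_◂_ : ∀ {A : Set} {m} → A → (Fin m → A) → Fin (suc m) → A
(x ◂ g) zero    = x
(x ◂ g) (suc i) = g i

-- Induction on the size of the domain: search for a first value whose remaining values can be found
-- by a search of their own.
Π-searchable : ∀ {A : Set} {_≈_ : A → A → Set} → (∀ {x} → x ≈ x) → Searchable _≈_ →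
               ∀ m → Searchable {Fin m → A} (λ f g → ∀ i → f i ≈ g i)
Π-searchable ≈-refl search zero P resp P? =
  map′ (λ p → none , p) (λ { (f , p) → resp (λ ()) p }) (P? none)
  where
  none : Fin 0 → _
  none ()
Π-searchable {A} {_≈_} ≈-refl search (suc m) P resp P? =
  map′ (λ { (x , g , p) → x ◂ g , p })
       (λ { (f , p) → f zero , f ∘ suc , resp (λ { zero → ≈-refl ; (suc i) → ≈-refl }) p })
       (search _
          (λ { x≈y (g , p) → g , resp (λ { zero → x≈y ; (suc i) → ≈-refl }) p })
          (λ x → Π-searchable ≈-refl search m (λ g → P (x ◂ g))
                   (λ f≈g → resp (λ { zero → ≈-refl ; (suc i) → f≈g i }))
                   (λ g → P? (x ◂ g))))

injective? : ∀ {m n} (f : Fin m → Fin n) → Dec (Injective _≡_ _≡_ f)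
injective? f = map′ (λ h {i} {j} → h i j) (λ h i j → h)
                    (all? λ i → all? λ j → (f i ≟ f j) →-dec (i ≟ j))

infix 4 _⊑?_
_⊑?_ : ∀ {m n} (H : Graph m) (G : Graph n) → Dec (H ⊑ G)
_⊑?_ {m} H G = Π-searchable refl Fin-searchable m _
  (λ f≗g → λ { (inj , hom) →
     (λ {i} {j} e → inj (trans (f≗g i) (trans e (≡-sym (f≗g j))))) ,
     (λ i j e → trans (cong₂ (adj G) (≡-sym (f≗g i)) (≡-sym (f≗g j))) (hom i j e)) })
  (λ f → injective? f ×-dec
         (all? λ i → all? λ j → (adj H i j ≟ᵇ true) →-dec (adj G (f i) (f j) ≟ᵇ true)))

containsMember? : ∀ {n} F (G : Graph n) → Dec (ContainsMember F G)
containsMember? F G = any? λ i → proj₂ (F i) ⊑? G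

saturated? : ∀ {n} F (G : Graph n) → Dec (Saturated F G)
saturated? F G = ¬? (containsMember? F G) ×-dec (all? λ u → all? λ v → added? u v)
  where
  added? : ∀ u v → Dec ((u≢v : u ≢ v) → adj G u v ≡ false → ContainsMember F (addEdge G u v u≢v))
  added? u v with u ≟ v
  ... | yes u≡v = yes λ u≢v → ⊥-elim (u≢v u≡v)
  ... | no u≢v  = map′ (λ h _ → h) (λ h → h u≢v)
                       ((adj G u v ≟ᵇ false) →-dec containsMember? F (addEdge G u v u≢v))

-- Inclusion and pointwise equality of graphs

infix 4 _⊆_ _≈_
_⊆_ : ∀ {n} → Graph n → Graph n → Set
G ⊆ G′ = ∀ i j → adj G i j ≡ true → adj G′ i j ≡ true

_≈_ : ∀ {n} → Graph n → Graph n → Set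
G ≈ G′ = ∀ i j → adj G i j ≡ adj G′ i j

≈-sym : ∀ {n} {G G′ : Graph n} → G ≈ G′ → G′ ≈ G
≈-sym e i j = ≡-sym (e i j)

≈⇒⊆ : ∀ {n} {G G′ : Graph n} → G ≈ G′ → G ⊆ G′
≈⇒⊆ e i j p = trans (≡-sym (e i j)) p

addEdge-⊆ : ∀ {n} {G G′ : Graph n} {u v} (u≢v : u ≢ v) → G ⊆ G′ → addEdge G u v u≢v ⊆ addEdge G′ u v u≢v
addEdge-⊆ {G = G} u≢v sub i j p with adj G i j in eq
... | true rewrite sub i j eq = refl
addEdge-⊆ {G′ = G′} u≢v sub i j p | false = trans (cong (adj G′ i j ∨_) p) (∨-zeroʳ _)

⊆-addEdge : ∀ {n} (G : Graph n) {u v} (u≢v : u ≢ v) → G ⊆ addEdge G u v u≢v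
⊆-addEdge G u≢v i j p = cong₂ _∨_ p refl

addEdge-new : ∀ {n} (G : Graph n) {u v} (u≢v : u ≢ v) → adj (addEdge G u v u≢v) u v ≡ true
addEdge-new G {u} {v} u≢v with u ≟ u | v ≟ v
... | yes _ | yes _ = ∨-zeroʳ (adj G u v)
... | no p  | _     = ⊥-elim (p refl)
... | yes _ | no p  = ⊥-elim (p refl)

contains-⊆ : ∀ {n F} {G G′ : Graph n} → G ⊆ G′ → ContainsMember F G → ContainsMember F G′
contains-⊆ sub (i , f , inj , hom) = i , f , inj , λ x y e → sub _ _ (hom x y e)

saturated-≈ : ∀ {n F} {G G′ : Graph n} → G ≈ G′ → Saturated F G → Saturated F G′
saturated-≈ {F = F} {G} {G′} e (free , add) =
  (λ c → free (contains-⊆ {F = F} {G′} {G} (≈⇒⊆ {G = G′} {G} (≈-sym {G = G} {G′} e)) c)) ,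
  λ u v u≢v na → contains-⊆ {F = F} {addEdge G u v u≢v} {addEdge G′ u v u≢v}
    (addEdge-⊆ {G = G} {G′} u≢v (≈⇒⊆ {G = G} {G′} e)) (add u v u≢v (trans (e u v) na))

-- The handshake identity trades the filtered list in `edges` for sums, where pointwise equality
-- applies term by term.
edges-≈ : ∀ {n} {G G′ : Graph n} → G ≈ G′ → edges G ≡ edges G′
edges-≈ {n} {G} {G′} e = ℕ.*-cancelˡ-≡ (edges G) (edges G′) 2 (begin
  2 * edges G        ≡⟨ cong (edges G +_) (ℕ.+-identityʳ _) ⟩
  edges G + edges G  ≡⟨ handshake G ⟨
  sum (degree G)     ≡⟨ sum-cong-≗ (λ i → sum-cong-≗ (λ j → cong ⟦_⟧ (e i j))) ⟩
  sum (degree G′)    ≡⟨ handshake G′ ⟩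
  edges G′ + edges G′  ≡⟨ cong (edges G′ +_) (ℕ.+-identityʳ _) ⟨
  2 * edges G′       ∎)
  where open ≡-Reasoning

-- Makes a graph of an arbitrary Boolean matrix, so that a search over matrices is a search over
-- graphs; every graph arises, by `symmetrise-adj`.
symmetrise : ∀ {n} → (Fin n → Fin n → Bool) → Graph n
symmetrise {n} a = record { adj = b ; sym = b-sym ; irrefl = b-irrefl }
  where
  distinct : Fin n → Fin n → Bool
  distinct i j = not ⌊ i ≟ j ⌋
  distinct-sym : ∀ i j → distinct i j ≡ distinct j i
  distinct-sym i j with i ≟ j | j ≟ i
  ... | yes _ | yes _ = refl
  ... | no _  | no _  = refl
  ... | yes p | no q  = ⊥-elim (q (≡-sym p))
  ... | no p  | yes q = ⊥-elim (p (≡-sym q))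
  b : Fin n → Fin n → Bool
  b i j = distinct i j ∧ (a i j ∨ a j i)
  b-sym : ∀ i j → b i j ≡ b j i
  b-sym i j = cong₂ _∧_ (distinct-sym i j) (∨-comm (a i j) (a j i))
  b-irrefl : ∀ i → b i i ≡ false
  b-irrefl i with i ≟ i
  ... | yes _ = refl
  ... | no p  = ⊥-elim (p refl)

symmetrise-cong : ∀ {n} {a a′ : Fin n → Fin n → Bool} → (∀ i j → a i j ≡ a′ i j) → symmetrise a ≈ symmetrise a′
symmetrise-cong e i j rewrite e i j | e j i = refl

symmetrise-adj : ∀ {n} (G : Graph n) → G ≈ symmetrise (adj G)
symmetrise-adj G i j with i ≟ j
... | yes refl = irrefl G i
... | no _ rewrite sym G j i with adj G i j
...   | true  = refl
...   | false = refl

Graph-searchable : ∀ n → Searchable (_≈_ {n})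
Graph-searchable n P resp P? =
  map′ (λ { (a , p) → symmetrise a , p })
       (λ { (G , p) → adj G , resp {G} {symmetrise (adj G)} (symmetrise-adj G) p })
       (Π-searchable (λ _ → refl) (Π-searchable refl Bool-searchable n) n (P ∘ symmetrise)
          (λ {a} {a′} e → resp {symmetrise a} {symmetrise a′} (symmetrise-cong e))
          (P? ∘ symmetrise))

-- Existence of saturated graphs and of the saturation number

empty : ∀ n → Graph n
empty n = record { adj = λ _ _ → false ; sym = λ _ _ → refl ; irrefl = λ _ → refl }

-- An edge in every member makes the empty graph a free starting point for greedy saturation.
HasEdge : AnyGraph → Set
HasEdge (m , H) = Σ (Fin m) λ i → Σ (Fin m) λ j → adj H i j ≡ true

least : {P : ℕ → Set} → (∀ s → Dec (P s)) → ∀ {b} → P b → Σ ℕ λ s → P s × (∀ t → P t → s ≤ t)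
least {P} P? {b} pb with P? 0
... | yes p0 = 0 , p0 , λ _ _ → z≤n
least P? {zero} pb | no ¬p0 = ⊥-elim (¬p0 pb)
least {P} P? {suc b} pb | no ¬p0 with least {P ∘ suc} (P? ∘ suc) pb
... | s , ps , min = suc s , ps , λ { zero p → ⊥-elim (¬p0 p) ; (suc t) p → s≤s (min t p) }

module _ (F : Family3) (hasEdge : ∀ i → HasEdge (F i)) where

  -- One pass suffices: a pair rejected at some stage stays forbidden as the graph grows.
  saturate : ∀ {n} (ps : List (Fin n × Fin n)) (G : Graph n) → ¬ ContainsMember F G →
    Σ (Graph n) λ G′ → G ⊆ G′ × ¬ ContainsMember F G′ ×
      (∀ u v → (u , v) ∈ ps → (u≢v : u ≢ v) → adj G′ u v ≡ false → ContainsMember F (addEdge G′ u v u≢v))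
  saturate [] G free = G , (λ _ _ p → p) , free , λ _ _ ()
  saturate ((x , y) ∷ ps) G free with x ≟ y
  ... | yes x≡y with saturate ps G free
  ...   | G′ , sub , free′ , add = G′ , sub , free′ ,
          λ { u v (here refl) u≢v → ⊥-elim (u≢v x≡y) ; u v (there q) → add u v q }
  saturate ((x , y) ∷ ps) G free | no x≢y with containsMember? F (addEdge G x y x≢y)
  ... | yes c with saturate ps G free
  ...   | G′ , sub , free′ , add = G′ , sub , free′ ,
          λ { u v (here refl) u≢v _ → contains-⊆ {F = F} {addEdge G u v x≢y} {addEdge G′ u v u≢v}
                                         (addEdge-⊆ {G = G} {G′} x≢y sub) c
            ; u v (there q) → add u v q }
  saturate {n} ((x , y) ∷ ps) G free | no x≢y | no ¬c with saturate ps (addEdge G x y x≢y) ¬c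
  ... | G′ , sub , free′ , add = G′ , (λ i j p → sub i j (⊆-addEdge G x≢y i j p)) , free′ ,
        λ { u v (here refl) u≢v na → ⊥-elim (true≢false (trans (≡-sym (sub u v (addEdge-new G x≢y))) na))
          ; u v (there q) → add u v q }
    where
    true≢false : true ≢ false
    true≢false ()

  saturatedExists : ∀ n → Σ (Graph n) (Saturated F)
  saturatedExists n with saturate (cartesianProduct (allFin n) (allFin n)) (empty n) emptyFree
    where
    emptyFree : ¬ ContainsMember F (empty n)
    emptyFree (i , f , _ , hom) with hasEdge i
    ... | x , y , e with hom x y e
    ...   | ()
  ... | G , _ , free , add = G , free ,
        λ u v → add u v (∈-cartesianProduct⁺ (∈-allFin u) (∈-allFin v))

  -- Being the edge count of a saturated graph is decidable by searching all graphs of order `n`,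
  -- and some count is attained, so a least one exists.
  satNumber : ∀ n → ∃[ s ] IsSat n F s
  satNumber n with saturatedExists n
  ... | G₀ , sat₀ with least attained? (G₀ , sat₀ , refl)
    where
    attained? : ∀ s → Dec (∃[ G ] (Saturated {n} F G × edges G ≡ s))
    attained? s = Graph-searchable n _
      (λ { {G} {G′} e (sat , eq) → saturated-≈ {F = F} {G} {G′} e sat ,
                                   trans (≡-sym (edges-≈ {G = G} {G′} e)) eq })
      (λ G → saturated? F G ×-dec (edges G ℕ.≟ s))
  ... | s , attained , min = s , attained , λ G sat → min (edges G) (G , sat , refl)

-- Cliques on four vertices

_∼⟨_⟩_ : ∀ {n} → Fin n → Graph n → Fin n → Set
u ∼⟨ G ⟩ v = adj G u v ≡ true

∼-sym : ∀ {n} {G : Graph n} {u v} → u ∼⟨ G ⟩ v → v ∼⟨ G ⟩ u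
∼-sym {G = G} {u} {v} = trans (sym G v u)

∼⇒≢ : ∀ {n} (G : Graph n) {u v} → u ∼⟨ G ⟩ v → u ≢ v
∼⇒≢ G {u} e refl with trans (≡-sym e) (irrefl G u)
... | ()

record K₄ {n} (G : Graph n) (a b c d : Fin n) : Set where
  constructor k₄
  field
    ab : a ∼⟨ G ⟩ b
    ac : a ∼⟨ G ⟩ c
    ad : a ∼⟨ G ⟩ d
    bc : b ∼⟨ G ⟩ c
    bd : b ∼⟨ G ⟩ d
    cd : c ∼⟨ G ⟩ d

K₄? : ∀ {n} (G : Graph n) a b c d → Dec (K₄ G a b c d)
K₄? G a b c d = map′ (λ (p , q , r , s , t , u) → k₄ p q r s t u) (λ (k₄ p q r s t u) → p , q , r , s , t , u)
  (a ∼? b ×-dec a ∼? c ×-dec a ∼? d ×-dec b ∼? c ×-dec b ∼? d ×-dec c ∼? d)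
  where
  _∼?_ : ∀ u v → Dec (u ∼⟨ G ⟩ v)
  u ∼? v = adj G u v ≟ᵇ true

module _ {n} {G : Graph n} where

  K₄-swap₁₂ : ∀ {a b c d} → K₄ G a b c d → K₄ G b a c d
  K₄-swap₁₂ (k₄ ab ac ad bc bd cd) = k₄ (∼-sym {G = G} ab) bc bd ac ad cd

  K₄-swap₂₃ : ∀ {a b c d} → K₄ G a b c d → K₄ G a c b d
  K₄-swap₂₃ (k₄ ab ac ad bc bd cd) = k₄ ac ab ad (∼-sym {G = G} bc) cd bd

  K₄-swap₃₄ : ∀ {a b c d} → K₄ G a b c d → K₄ G a b d c
  K₄-swap₃₄ (k₄ ab ac ad bc bd cd) = k₄ ab ad ac bd bc (∼-sym {G = G} cd)

InK₄ : ∀ {n} → Graph n → Fin n → Set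
InK₄ G a = ∃ λ b → ∃ λ c → ∃ λ d → K₄ G a b c d

inK₄? : ∀ {n} (G : Graph n) a → Dec (InK₄ G a)
inK₄? G a = any? λ b → any? λ c → any? λ d → K₄? G a b c d

-- The forbidden graphs

-- Adjacency is decided by membership in an explicit list, so facts about a concrete graph can be
-- checked by evaluation.
graphOf : ∀ {m} → List (Fin m × Fin m) → Graph m
graphOf es = symmetrise λ i j → ⌊ (i , j) ∈? es ⌋
  where open DecMembership (≡-dec _≟_ _≟_) using (_∈?_)

embed : ∀ {m n} {G : Graph n} {es : List (Fin m × Fin m)} (vs : Vec (Fin n) m) → Unique vs →
  All (λ (i , j) → lookup vs i ∼⟨ G ⟩ lookup vs j) es → graphOf es ⊑ G
embed {G = G} {es} vs unique pres = lookup vs , (λ {i} {j} → lookup-injective unique i j) , hom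
  where
  open DecMembership (≡-dec _≟_ _≟_) using (_∈?_)
  hom : ∀ i j → i ∼⟨ graphOf es ⟩ j → lookup vs i ∼⟨ G ⟩ lookup vs j
  hom i j e with i ≟ j | (i , j) ∈? es | (j , i) ∈? es
  hom i j () | yes _ | _     | _
  hom i j e  | no _  | yes p | _     = All-lookup pres p
  hom i j e  | no _  | no _  | yes p = ∼-sym {G = G} (All-lookup pres p)
  hom i j () | no _  | no _  | no _

clique : ∀ {m} → Fin m → Fin m → Fin m → Fin m → List (Fin m × Fin m)
clique a b c d = (a , b) ∷ (a , c) ∷ (a , d) ∷ (b , c) ∷ (b , d) ∷ (c , d) ∷ []

attachedTwice : Graph 5
attachedTwice = graphOf ((0F , 4F) ∷ (1F , 4F) ∷ clique 0F 1F 2F 3F)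

sharedVertex : Graph 7
sharedVertex = graphOf (clique 0F 1F 2F 3F ++ clique 0F 4F 5F 6F)

barbell : Graph 8
barbell = graphOf ((0F , 4F) ∷ clique 0F 1F 2F 3F ++ clique 4F 5F 6F 7F)

-- Copies created by a new edge

infix 4 _⋢_
_⋢_ : ∀ {m n} → Graph m → Graph n → Set
H ⋢ G = ¬ (H ⊑ G)

module _ {n} (G : Graph n) where

  -- The roles the new edge `uv` can play in a forbidden graph: an edge inside a K₄ (`common`), the
  -- bridge of a `barbell` (`joins`), or the second edge attaching an outside vertex to a K₄
  -- (`attachesˡ`, `attachesʳ`).
  data Completes (u v : Fin n) : Set where
    common    : ∀ {x y} → u ∼⟨ G ⟩ x → u ∼⟨ G ⟩ y → v ∼⟨ G ⟩ x → v ∼⟨ G ⟩ y → x ∼⟨ G ⟩ y → Completes u v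
    joins     : InK₄ G u → InK₄ G v → Completes u v
    attachesˡ : ∀ {b c d} → K₄ G u b c d → v ∼⟨ G ⟩ b → Completes u v
    attachesʳ : ∀ {b c d} → K₄ G v b c d → u ∼⟨ G ⟩ b → Completes u v

module Copy {n} (G : Graph n) {u v : Fin n} (u≢v : u ≢ v) {m} (H : Graph m) (H⋢G : H ⋢ G)
  (f : Fin m → Fin n) (inj : Injective _≡_ _≡_ f)
  (hom : ∀ i j → i ∼⟨ H ⟩ j → f i ∼⟨ addEdge G u v u≢v ⟩ f j) where

  oldOrNew : ∀ x y → x ∼⟨ addEdge G u v u≢v ⟩ y → x ∼⟨ G ⟩ y ⊎ (x ≡ u × y ≡ v) ⊎ (x ≡ v × y ≡ u)
  oldOrNew x y e with adj G x y | x ≟ u | y ≟ v | x ≟ v | y ≟ u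
  ... | true  | _     | _     | _     | _     = inj₁ refl
  ... | false | yes p | yes q | _     | _     = inj₂ (inj₁ (p , q))
  ... | false | yes _ | no _  | yes p | yes q = inj₂ (inj₂ (p , q))
  ... | false | no _  | _     | yes p | yes q = inj₂ (inj₂ (p , q))
  oldOrNew x y () | false | no _  | _     | no _  | _
  oldOrNew x y () | false | no _  | _     | yes _ | no _
  oldOrNew x y () | false | yes _ | no _  | no _  | _
  oldOrNew x y () | false | yes _ | no _  | yes _ | no _

  -- If no edge of `H` were mapped onto `uv`, then `f` would embed `H` in `G` already.
  newEdgeUsed : ∃₂ λ i j → i ∼⟨ H ⟩ j × f i ≡ u × f j ≡ v
  newEdgeUsed with any? (λ i → any? (λ j → (adj H i j ≟ᵇ true) ×-dec (f i ≟ u) ×-dec (f j ≟ v)))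
  ... | yes used = used
  ... | no ¬used = ⊥-elim (H⋢G (f , inj , old))
    where
    old : ∀ i j → i ∼⟨ H ⟩ j → f i ∼⟨ G ⟩ f j
    old i j e with oldOrNew (f i) (f j) (hom i j e)
    ... | inj₁ p = p
    ... | inj₂ (inj₁ (p , q)) = ⊥-elim (¬used (i , j , e , p , q))
    ... | inj₂ (inj₂ (p , q)) = ⊥-elim (¬used (j , i , ∼-sym {G = H} e , q , p))

  module _ {i j} (fi : f i ≡ u) (fj : f j ≡ v) where

    -- By injectivity only the edge `ij` itself can be mapped onto `uv`.
    otherEdgeOld : ∀ {x y} → x ∼⟨ H ⟩ y → ¬ (x ≡ i × y ≡ j) → ¬ (x ≡ j × y ≡ i) → f x ∼⟨ G ⟩ f y
    otherEdgeOld {x} {y} e ¬ij ¬ji with oldOrNew (f x) (f y) (hom x y e)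
    ... | inj₁ p = p
    ... | inj₂ (inj₁ (p , q)) = ⊥-elim (¬ij (inj (trans p (≡-sym fi)) , inj (trans q (≡-sym fj))))
    ... | inj₂ (inj₂ (p , q)) = ⊥-elim (¬ji (inj (trans p (≡-sym fj)) , inj (trans q (≡-sym fi))))

    -- The other two vertices of the clique become adjacent common neighbours of `u` and `v`; the
    -- five edges besides `ij` are old.
    K₄-completes : ∀ {p q} → K₄ H i j p q → Completes G u v
    K₄-completes {p} {q} (k₄ _ ip iq jp jq pq) = subst₂ (Completes G) fi fj (common
      (otherEdgeOld ip (λ (_ , e) → ∼⇒≢ H jp (≡-sym e)) (λ (_ , e) → ∼⇒≢ H ip (≡-sym e)))
      (otherEdgeOld iq (λ (_ , e) → ∼⇒≢ H jq (≡-sym e)) (λ (_ , e) → ∼⇒≢ H iq (≡-sym e)))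
      (otherEdgeOld jp (λ (_ , e) → ∼⇒≢ H jp (≡-sym e)) (λ (_ , e) → ∼⇒≢ H ip (≡-sym e)))
      (otherEdgeOld jq (λ (_ , e) → ∼⇒≢ H jq (≡-sym e)) (λ (_ , e) → ∼⇒≢ H iq (≡-sym e)))
      (otherEdgeOld pq (λ (e , _) → ∼⇒≢ H ip (≡-sym e)) (λ (e , _) → ∼⇒≢ H jp (≡-sym e))))

    -- A clique that avoids one end of `ij` does not use the new edge.
    K₄-old : ∀ {a b c d} → K₄ H a b c d → (a ≢ j × b ≢ j × c ≢ j × d ≢ j) ⊎ (a ≢ i × b ≢ i × c ≢ i × d ≢ i) →
             K₄ G (f a) (f b) (f c) (f d)
    K₄-old (k₄ ab ac ad bc bd cd) (inj₁ (a≢ , b≢ , c≢ , d≢)) = k₄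
      (otherEdgeOld ab (b≢ ∘ proj₂) (a≢ ∘ proj₁)) (otherEdgeOld ac (c≢ ∘ proj₂) (a≢ ∘ proj₁))
      (otherEdgeOld ad (d≢ ∘ proj₂) (a≢ ∘ proj₁)) (otherEdgeOld bc (c≢ ∘ proj₂) (b≢ ∘ proj₁))
      (otherEdgeOld bd (d≢ ∘ proj₂) (b≢ ∘ proj₁)) (otherEdgeOld cd (d≢ ∘ proj₂) (c≢ ∘ proj₁))
    K₄-old (k₄ ab ac ad bc bd cd) (inj₂ (a≢ , b≢ , c≢ , d≢)) = k₄
      (otherEdgeOld ab (a≢ ∘ proj₁) (b≢ ∘ proj₂)) (otherEdgeOld ac (a≢ ∘ proj₁) (c≢ ∘ proj₂))
      (otherEdgeOld ad (a≢ ∘ proj₁) (d≢ ∘ proj₂)) (otherEdgeOld bc (b≢ ∘ proj₁) (c≢ ∘ proj₂))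
      (otherEdgeOld bd (b≢ ∘ proj₁) (d≢ ∘ proj₂)) (otherEdgeOld cd (c≢ ∘ proj₁) (d≢ ∘ proj₂))

EdgeInK₄ : ∀ {m} → Graph m → Fin m → Fin m → Set
EdgeInK₄ H i j = ∃₂ λ p q → K₄ H i j p q

edgeInK₄? : ∀ {m} (H : Graph m) i j → Dec (EdgeInK₄ H i j)
edgeInK₄? H i j = any? λ p → any? λ q → K₄? H i j p q

infix 4 _∼?⟨_⟩_
_∼?⟨_⟩_ : ∀ {m} i (H : Graph m) j → Dec (i ∼⟨ H ⟩ j)
i ∼?⟨ H ⟩ j = adj H i j ≟ᵇ true

abstract

  -- This and the next two lemmas list the possible positions of the new edge in a copy: inside a
  -- K₄, or one of the few connecting edges. They are finite checks over all pairs of vertices.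
  attachedTwice-edges : ∀ i j → i ∼⟨ attachedTwice ⟩ j → EdgeInK₄ attachedTwice i j ⊎
    ((i ≡ 0F × j ≡ 4F) ⊎ (i ≡ 1F × j ≡ 4F)) ⊎ ((i ≡ 4F × j ≡ 0F) ⊎ (i ≡ 4F × j ≡ 1F))
  attachedTwice-edges = from-yes (all? λ i → all? λ j → (i ∼?⟨ attachedTwice ⟩ j) →-dec
    (edgeInK₄? attachedTwice i j ⊎-dec
      (((i ≟ 0F) ×-dec (j ≟ 4F)) ⊎-dec ((i ≟ 1F) ×-dec (j ≟ 4F))) ⊎-dec
      (((i ≟ 4F) ×-dec (j ≟ 0F)) ⊎-dec ((i ≟ 4F) ×-dec (j ≟ 1F)))))

  sharedVertex-edges : ∀ i j → i ∼⟨ sharedVertex ⟩ j → EdgeInK₄ sharedVertex i j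
  sharedVertex-edges = from-yes (all? λ i → all? λ j → (i ∼?⟨ sharedVertex ⟩ j) →-dec edgeInK₄? sharedVertex i j)

  barbell-edges : ∀ i j → i ∼⟨ barbell ⟩ j → EdgeInK₄ barbell i j ⊎ (i ≡ 0F × j ≡ 4F) ⊎ (i ≡ 4F × j ≡ 0F)
  barbell-edges = from-yes (all? λ i → all? λ j → (i ∼?⟨ barbell ⟩ j) →-dec
    (edgeInK₄? barbell i j ⊎-dec ((i ≟ 0F) ×-dec (j ≟ 4F)) ⊎-dec ((i ≟ 4F) ×-dec (j ≟ 0F))))

-- Containment for the unpadded graphs. On at least `k + 8` vertices it is equivalent to containing
-- a member of `family k`.
data Contains {n} (G : Graph n) : Set where
  attached : attachedTwice ⊑ G → Contains G
  shared   : sharedVertex ⊑ G → Contains G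
  joined   : barbell ⊑ G → Contains G

-- Trace `uv` back to the edge of the forbidden graph that it represents. An edge inside a K₄ gives
-- `common`. For a connecting edge, every K₄ of the copy misses one of its ends and so is old, as is
-- the other attaching edge.
completes : ∀ {n} (G : Graph n) {u v} (u≢v : u ≢ v) → ¬ Contains G → Contains (addEdge G u v u≢v) → Completes G u v
completes G {u} {v} u≢v free (attached (f , inj , hom)) = kind newEdgeUsed
  where
  open Copy G u≢v attachedTwice (free ∘ attached) f inj hom
  kind : (∃₂ λ i j → i ∼⟨ attachedTwice ⟩ j × f i ≡ u × f j ≡ v) → Completes G u v
  kind (i , j , e , fi , fj) with attachedTwice-edges i j e
  ... | inj₁ (_ , _ , k) = K₄-completes fi fj k
  ... | inj₂ (inj₁ (inj₁ (refl , refl))) = subst₂ (Completes G) fi fj (attachesˡ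
      (K₄-old fi fj {0F} {1F} {2F} {3F} (k₄ refl refl refl refl refl refl) (inj₁ ((λ ()) , (λ ()) , (λ ()) , (λ ()))))
      (otherEdgeOld fi fj {4F} {1F} refl (λ ()) (λ ())))
  ... | inj₂ (inj₁ (inj₂ (refl , refl))) = subst₂ (Completes G) fi fj (attachesˡ
      (K₄-old fi fj {1F} {0F} {2F} {3F} (k₄ refl refl refl refl refl refl) (inj₁ ((λ ()) , (λ ()) , (λ ()) , (λ ()))))
      (otherEdgeOld fi fj {4F} {0F} refl (λ ()) (λ ())))
  ... | inj₂ (inj₂ (inj₁ (refl , refl))) = subst₂ (Completes G) fi fj (attachesʳ
      (K₄-old fi fj {0F} {1F} {2F} {3F} (k₄ refl refl refl refl refl refl) (inj₂ ((λ ()) , (λ ()) , (λ ()) , (λ ()))))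
      (otherEdgeOld fi fj {4F} {1F} refl (λ ()) (λ ())))
  ... | inj₂ (inj₂ (inj₂ (refl , refl))) = subst₂ (Completes G) fi fj (attachesʳ
      (K₄-old fi fj {1F} {0F} {2F} {3F} (k₄ refl refl refl refl refl refl) (inj₂ ((λ ()) , (λ ()) , (λ ()) , (λ ()))))
      (otherEdgeOld fi fj {4F} {0F} refl (λ ()) (λ ())))
completes G {u} {v} u≢v free (shared (f , inj , hom)) = kind newEdgeUsed
  where
  open Copy G u≢v sharedVertex (free ∘ shared) f inj hom
  kind : (∃₂ λ i j → i ∼⟨ sharedVertex ⟩ j × f i ≡ u × f j ≡ v) → Completes G u v
  kind (i , j , e , fi , fj) = K₄-completes fi fj (proj₂ (proj₂ (sharedVertex-edges i j e)))
completes G {u} {v} u≢v free (joined (f , inj , hom)) = kind newEdgeUsed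
  where
  open Copy G u≢v barbell (free ∘ joined) f inj hom
  kind : (∃₂ λ i j → i ∼⟨ barbell ⟩ j × f i ≡ u × f j ≡ v) → Completes G u v
  kind (i , j , e , fi , fj) with barbell-edges i j e
  ... | inj₁ (_ , _ , k) = K₄-completes fi fj k
  ... | inj₂ (inj₁ (refl , refl)) = subst₂ (Completes G) fi fj (joins
      (_ , _ , _ , K₄-old fi fj {0F} {1F} {2F} {3F} (k₄ refl refl refl refl refl refl) (inj₁ ((λ ()) , (λ ()) , (λ ()) , (λ ()))))
      (_ , _ , _ , K₄-old fi fj {4F} {5F} {6F} {7F} (k₄ refl refl refl refl refl refl) (inj₂ ((λ ()) , (λ ()) , (λ ()) , (λ ())))))
  ... | inj₂ (inj₂ (refl , refl)) = subst₂ (Completes G) fi fj (joins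
      (_ , _ , _ , K₄-old fi fj {4F} {5F} {6F} {7F} (k₄ refl refl refl refl refl refl) (inj₁ ((λ ()) , (λ ()) , (λ ()) , (λ ()))))
      (_ , _ , _ , K₄-old fi fj {0F} {1F} {2F} {3F} (k₄ refl refl refl refl refl refl) (inj₂ ((λ ()) , (λ ()) , (λ ()) , (λ ())))))

-- Padding with isolated vertices

addIsolated : ∀ {m} → Graph m → Graph (suc m)
addIsolated {m} H = record { adj = a ; sym = a-sym ; irrefl = a-irrefl }
  where
  a : Fin (suc m) → Fin (suc m) → Bool
  a (suc i) (suc j) = adj H i j
  a zero    _       = false
  a (suc _) zero    = false
  a-sym : ∀ i j → a i j ≡ a j i
  a-sym (suc i) (suc j) = sym H i j
  a-sym zero    zero    = refl
  a-sym zero    (suc _) = refl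
  a-sym (suc _) zero    = refl
  a-irrefl : ∀ i → a i i ≡ false
  a-irrefl zero    = refl
  a-irrefl (suc i) = irrefl H i

pad : ∀ {m} k → Graph m → Graph (k + m)
pad zero    H = H
pad (suc k) H = addIsolated (pad k H)

pad-⊑⁻ : ∀ {m n} k {H : Graph m} {G : Graph n} → pad k H ⊑ G → H ⊑ G
pad-⊑⁻ zero c = c
pad-⊑⁻ (suc k) {H} {G} (f , inj , hom) =
  pad-⊑⁻ k {H} {G} (f ∘ suc , suc-injective ∘ inj , λ i j → hom (suc i) (suc j))

-- If every vertex had a preimage, choosing one for each would inject `Fin n` into the smaller
-- `Fin m`.
missedVertex : ∀ {m n} (f : Fin m → Fin n) → m < n → ∃ λ y → ∀ i → f i ≢ y
missedVertex {m} {n} f m<n with any? (λ y → all? (λ i → ¬? (f i ≟ y)))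
... | yes missed = missed
... | no ¬missed = ⊥-elim (ℕ.<⇒≱ m<n (injective⇒≤ {f = proj₁ ∘ preimage} preimage-injective))
  where
  preimage : ∀ y → ∃ λ i → f i ≡ y
  preimage y with any? (λ i → f i ≟ y)
  ... | yes p = p
  ... | no ¬p = ⊥-elim (¬missed (y , λ i e → ¬p (i , e)))
  preimage-injective : ∀ {y z} → proj₁ (preimage y) ≡ proj₁ (preimage z) → y ≡ z
  preimage-injective {y} {z} e =
    trans (≡-sym (proj₂ (preimage y))) (trans (cong f e) (proj₂ (preimage z)))

-- An isolated vertex may be sent to any vertex not yet used, and the size hypothesis leaves one at
-- each stage.
pad-⊑⁺ : ∀ {m n} k {H : Graph m} {G : Graph n} → k + m ≤ n → H ⊑ G → pad k H ⊑ G
pad-⊑⁺ zero    _    c = c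
pad-⊑⁺ (suc k) {H} {G} size c with pad-⊑⁺ k {H} {G} (ℕ.<⇒≤ size) c
... | f , inj , hom with missedVertex f size
...   | y , missed = y ◂ f , ◂-injective , ◂-hom
  where
  ◂-injective : Injective _≡_ _≡_ (y ◂ f)
  ◂-injective {zero}  {zero}  e = refl
  ◂-injective {zero}  {suc j} e = ⊥-elim (missed j (≡-sym e))
  ◂-injective {suc i} {zero}  e = ⊥-elim (missed i e)
  ◂-injective {suc i} {suc j} e = cong suc (inj e)
  ◂-hom : ∀ i j → i ∼⟨ pad (suc k) H ⟩ j → (y ◂ f) i ∼⟨ G ⟩ (y ◂ f) j
  ◂-hom zero    j       ()
  ◂-hom (suc i) zero    ()
  ◂-hom (suc i) (suc j) e = hom i j e

-- Padding the largest graph keeps the three orders 5, 7 and `k + 8` distinct, and the order `k + 8`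
-- tells the families apart.
family : ℕ → Family3
family k 0F = 5 , attachedTwice
family k 1F = 7 , sharedVertex
family k 2F = k + 8 , pad k barbell

member⇒contains : ∀ {n} k {G : Graph n} → ContainsMember (family k) G → Contains G
member⇒contains k (0F , c) = attached c
member⇒contains k (1F , c) = shared c
member⇒contains k {G} (2F , c) = joined (pad-⊑⁻ k {G = G} c)

contains⇒member : ∀ {n} k {G : Graph n} → k + 8 ≤ n → Contains G → ContainsMember (family k) G
contains⇒member k size (attached c) = 0F , c
contains⇒member k size (shared c)   = 1F , c
contains⇒member k {G} size (joined c) = 2F , pad-⊑⁺ k {barbell} {G} size c

pad-hasEdge : ∀ {m} k {H : Graph m} → HasEdge (m , H) → HasEdge (k + m , pad k H)
pad-hasEdge zero    e = e
pad-hasEdge (suc k) {H} e with pad-hasEdge k {H} e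
... | i , j , p = suc i , suc j , p

family-hasEdge : ∀ k i → HasEdge (family k i)
family-hasEdge k 0F = 0F , 1F , refl
family-hasEdge k 1F = 0F , 1F , refl
family-hasEdge k 2F = pad-hasEdge k {barbell} (0F , 1F , refl)

≅⇒≡ : ∀ {m n} {G : Graph m} {H : Graph n} → G ≅ H → m ≡ n
≅⇒≡ (f , g , gf , fg , _) = ℕ.≤-antisym
  (injective⇒≤ {f = f} (λ {x} {y} e → trans (≡-sym (gf x)) (trans (cong g e) (gf y))))
  (injective⇒≤ {f = g} (λ {x} {y} e → trans (≡-sym (fg x)) (trans (cong f e) (fg y))))

order : ℕ → Fin 3 → ℕ
order k i = proj₁ (family k i)

order-family : ∀ {k l} i j → family k i ≅' family l j → order k i ≡ order l j
order-family {k} {l} i j = ≅⇒≡ {G = proj₂ (family k i)} {proj₂ (family l j)}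

7<k+8 : ∀ k → 7 < k + 8
7<k+8 k = ℕ.m≤n+m 8 k

family-size3 : ∀ k → IsFamilyOfSize3 (family k)
family-size3 k i j i≢j iso = distinct i j i≢j (order-family {k} {k} i j iso)
  where
  distinct : ∀ i j → i ≢ j → order k i ≢ order k j
  distinct 0F 0F d = λ _ → d refl
  distinct 1F 1F d = λ _ → d refl
  distinct 2F 2F d = λ _ → d refl
  distinct 0F 1F _ = λ ()
  distinct 1F 0F _ = λ ()
  distinct 0F 2F _ = ℕ.<⇒≢ (ℕ.<-trans (ℕ.m≤n+m 6 1) (7<k+8 k))
  distinct 2F 0F _ = ≢-sym (ℕ.<⇒≢ (ℕ.<-trans (ℕ.m≤n+m 6 1) (7<k+8 k)))
  distinct 1F 2F _ = ℕ.<⇒≢ (7<k+8 k)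
  distinct 2F 1F _ = ≢-sym (ℕ.<⇒≢ (7<k+8 k))

families-distinct : ∀ k l → k ≢ l → ¬ SameFamily (family k) (family l)
families-distinct k l k≢l (to , _) with to 2F
... | 0F , iso = ℕ.<⇒≢ (ℕ.<-trans (ℕ.m≤n+m 6 1) (7<k+8 k)) (≡-sym (order-family {k} {l} 2F 0F iso))
... | 1F , iso = ℕ.<⇒≢ (7<k+8 k) (≡-sym (order-family {k} {l} 2F 1F iso))
... | 2F , iso = k≢l (ℕ.+-cancelʳ-≡ 8 k l (order-family {k} {l} 2F 2F iso))

-- Copies of the forbidden graphs and the separation of cliques

Off : ∀ {n} (a b c d x : Fin n) → Set
Off a b c d x = a ≢ x × b ≢ x × c ≢ x × d ≢ x

module _ {n} {G : Graph n} where

  private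
    infix 4 _~_
    _~_ : Fin n → Fin n → Set
    u ~ v = u ∼⟨ G ⟩ v
    ~-sym : ∀ {u v} → u ~ v → v ~ u
    ~-sym = ∼-sym {G = G}
    ~⇒≢ : ∀ {u v} → u ~ v → u ≢ v
    ~⇒≢ = ∼⇒≢ G

  attachedTwice-copy : ∀ {a b c d e} → K₄ G a b c d → a ~ e → b ~ e → c ≢ e → d ≢ e → attachedTwice ⊑ G
  attachedTwice-copy {a} {b} {c} {d} {e} (k₄ ab ac ad bc bd cd) ae be c≢e d≢e = embed {G = G}
    (a ∷ b ∷ c ∷ d ∷ e ∷ [])
    ((~⇒≢ ab ∷ ~⇒≢ ac ∷ ~⇒≢ ad ∷ ~⇒≢ ae ∷ []) ∷ (~⇒≢ bc ∷ ~⇒≢ bd ∷ ~⇒≢ be ∷ []) ∷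
     (~⇒≢ cd ∷ c≢e ∷ []) ∷ (d≢e ∷ []) ∷ [] ∷ [])
    (ae ∷ be ∷ ab ∷ ac ∷ ad ∷ bc ∷ bd ∷ cd ∷ [])

  sharedVertex-copy : ∀ {a b c d e f g} → K₄ G a b c d → K₄ G a e f g →
    Off a b c d e → Off a b c d f → Off a b c d g → sharedVertex ⊑ G
  sharedVertex-copy {a} {b} {c} {d} {e} {f} {g} (k₄ ab ac ad bc bd cd) (k₄ ae af ag ef eg fg)
    (a≢e , b≢e , c≢e , d≢e) (a≢f , b≢f , c≢f , d≢f) (a≢g , b≢g , c≢g , d≢g) = embed {G = G}
    (a ∷ b ∷ c ∷ d ∷ e ∷ f ∷ g ∷ [])
    ((~⇒≢ ab ∷ ~⇒≢ ac ∷ ~⇒≢ ad ∷ a≢e ∷ a≢f ∷ a≢g ∷ []) ∷ (~⇒≢ bc ∷ ~⇒≢ bd ∷ b≢e ∷ b≢f ∷ b≢g ∷ []) ∷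
     (~⇒≢ cd ∷ c≢e ∷ c≢f ∷ c≢g ∷ []) ∷ (d≢e ∷ d≢f ∷ d≢g ∷ []) ∷
     (~⇒≢ ef ∷ ~⇒≢ eg ∷ []) ∷ (~⇒≢ fg ∷ []) ∷ [] ∷ [])
    (ab ∷ ac ∷ ad ∷ bc ∷ bd ∷ cd ∷ ae ∷ af ∷ ag ∷ ef ∷ eg ∷ fg ∷ [])

  barbell-copy : ∀ {a b c d e f g h} → K₄ G a b c d → K₄ G e f g h → a ~ e →
    Off a b c d e → Off a b c d f → Off a b c d g → Off a b c d h → barbell ⊑ G
  barbell-copy {a} {b} {c} {d} {e} {f} {g} {h} (k₄ ab ac ad bc bd cd) (k₄ ef eg eh fg fh gh) ae
    (a≢e , b≢e , c≢e , d≢e) (a≢f , b≢f , c≢f , d≢f) (a≢g , b≢g , c≢g , d≢g) (a≢h , b≢h , c≢h , d≢h) = embed {G = G}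
    (a ∷ b ∷ c ∷ d ∷ e ∷ f ∷ g ∷ h ∷ [])
    ((~⇒≢ ab ∷ ~⇒≢ ac ∷ ~⇒≢ ad ∷ a≢e ∷ a≢f ∷ a≢g ∷ a≢h ∷ []) ∷ (~⇒≢ bc ∷ ~⇒≢ bd ∷ b≢e ∷ b≢f ∷ b≢g ∷ b≢h ∷ []) ∷
     (~⇒≢ cd ∷ c≢e ∷ c≢f ∷ c≢g ∷ c≢h ∷ []) ∷ (d≢e ∷ d≢f ∷ d≢g ∷ d≢h ∷ []) ∷
     (~⇒≢ ef ∷ ~⇒≢ eg ∷ ~⇒≢ eh ∷ []) ∷ (~⇒≢ fg ∷ ~⇒≢ fh ∷ []) ∷ (~⇒≢ gh ∷ []) ∷ [] ∷ [])
    (ae ∷ ab ∷ ac ∷ ad ∷ bc ∷ bd ∷ cd ∷ ef ∷ eg ∷ eh ∷ fg ∷ fh ∷ gh ∷ [])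

  -- Otherwise `e` lies outside the clique of `a` and has a K₄ of its own. If that K₄ contains `a`,
  -- the two cliques share only `a` and form a `sharedVertex`; if not, they are disjoint and `ae`
  -- makes them a `barbell`.
  inK₄-neighbour : ¬ Contains G → ∀ {a b c d e} → K₄ G a b c d → InK₄ G e → a ~ e → b ≡ e ⊎ c ≡ e ⊎ d ≡ e
  inK₄-neighbour free {a} {b} {c} {d} {e} K (f , g , h , K′) ae with b ≟ e | c ≟ e | d ≟ e
  ... | yes p | _     | _     = inj₁ p
  ... | no _  | yes p | _     = inj₂ (inj₁ p)
  ... | no _  | no _  | yes p = inj₂ (inj₂ p)
  ... | no b≢e | no c≢e | no d≢e = ⊥-elim (absurd K′)
    where
    offₑ : Off a b c d e
    offₑ = ~⇒≢ ae , b≢e , c≢e , d≢e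
    -- `a` is the only neighbour of `e` in the clique, since a second one would attach `e` twice.
    off : ∀ {x} → e ~ x → a ≢ x → Off a b c d x
    off {x} ex a≢x = a≢x ,
      (λ { refl → free (attached (attachedTwice-copy K ae (~-sym ex) c≢e d≢e)) }) ,
      (λ { refl → free (attached (attachedTwice-copy (K₄-swap₂₃ K) ae (~-sym ex) b≢e d≢e)) }) ,
      (λ { refl → free (attached (attachedTwice-copy (K₄-swap₂₃ (K₄-swap₃₄ K)) ae (~-sym ex) b≢e c≢e)) })
    sharing : ∀ {g h} → ¬ K₄ G e a g h
    sharing K″@(k₄ ea eg eh ag ah gh) = free (shared
      (sharedVertex-copy K (K₄-swap₁₂ K″) offₑ (off eg (~⇒≢ ag)) (off eh (~⇒≢ ah))))
    absurd : ¬ K₄ G e f g h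
    absurd K″@(k₄ ef eg eh fg fh gh) with a ≟ f | a ≟ g | a ≟ h
    ... | yes refl | _ | _ = sharing K″
    ... | no _ | yes refl | _ = sharing (K₄-swap₂₃ K″)
    ... | no _ | no _ | yes refl = sharing (K₄-swap₂₃ (K₄-swap₃₄ K″))
    ... | no a≢f | no a≢g | no a≢h = free (joined (barbell-copy K K″ ae offₑ (off ef a≢f) (off eg a≢g) (off eh a≢h)))

-- The lower bound

module _ {n} (G : Graph n) (free : ¬ Contains G) where

  private
    infix 4 _~_
    _~_ : Fin n → Fin n → Set
    u ~ v = u ∼⟨ G ⟩ v

  inᵇ : Fin n → Bool
  inᵇ v = ⌊ inK₄? G v ⌋

  covered uncovered : ℕ
  covered = ∑[ v < n ] ⟦ inᵇ v ⟧
  uncovered = ∑[ v < n ] ⟦ not (inᵇ v) ⟧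

  covered+uncovered : covered + uncovered ≡ n
  covered+uncovered = begin
    covered + uncovered                       ≡⟨ ∑-distrib-+ (λ v → ⟦ inᵇ v ⟧) (λ v → ⟦ not (inᵇ v) ⟧) ⟨
    ∑[ v < n ] (⟦ inᵇ v ⟧ + ⟦ not (inᵇ v) ⟧)  ≡⟨ sum-cong-≗ (λ v → one (inᵇ v)) ⟩
    ∑[ v < n ] 1                              ≡⟨ ∑-const n 1 ⟩
    n * 1                                     ≡⟨ ℕ.*-identityʳ n ⟩
    n                                         ∎
    where
    open ≡-Reasoning
    one : ∀ b → ⟦ b ⟧ + ⟦ not b ⟧ ≡ 1
    one true  = refl
    one false = refl

  inᵇ-true : ∀ {v} → InK₄ G v → inᵇ v ≡ true
  inᵇ-true {v} p with inK₄? G v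
  ... | yes _ = refl
  ... | no ¬p = ⊥-elim (¬p p)

  inᵇ-false : ∀ {v} → ¬ InK₄ G v → inᵇ v ≡ false
  inᵇ-false {v} ¬p with inK₄? G v
  ... | yes p = ⊥-elim (¬p p)
  ... | no _  = refl

  inner : Fin n → Fin n → ℕ
  inner v w = ⟦ inᵇ v ∧ (inᵇ w ∧ adj G v w) ⟧

  inner-sym : ∀ v w → inner v w ≡ inner w v
  inner-sym v w rewrite sym G v w with inᵇ v | inᵇ w
  ... | true  | true  = refl
  ... | true  | false = refl
  ... | false | true  = refl
  ... | false | false = refl

  -- By `inK₄-neighbour`, the covered neighbours of a covered vertex are exactly the other three
  -- vertices of its clique.
  inner-row : ∀ v → ∑[ w < n ] inner v w ≡ 3 * ⟦ inᵇ v ⟧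
  inner-row v with inK₄? G v
  ... | no _ = trans (∑-const n 0) (ℕ.*-zeroʳ n)
  ... | yes (b , c , d , K@(k₄ vb vc vd bc bd cd)) = begin
    ∑[ w < n ] ⟦ inᵇ w ∧ adj G v w ⟧
      ≡⟨ sum-cong-≗ member ⟩
    ∑[ w < n ] (⟦ ⌊ b ≟ w ⌋ ⟧ + (⟦ ⌊ c ≟ w ⌋ ⟧ + ⟦ ⌊ d ≟ w ⌋ ⟧))
      ≡⟨ ∑-distrib-+ (λ w → ⟦ ⌊ b ≟ w ⌋ ⟧) (λ w → ⟦ ⌊ c ≟ w ⌋ ⟧ + ⟦ ⌊ d ≟ w ⌋ ⟧) ⟩
    ∑[ w < n ] ⟦ ⌊ b ≟ w ⌋ ⟧ + ∑[ w < n ] (⟦ ⌊ c ≟ w ⌋ ⟧ + ⟦ ⌊ d ≟ w ⌋ ⟧)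
      ≡⟨ cong₂ _+_ (∑-indicator b) (trans (∑-distrib-+ (λ w → ⟦ ⌊ c ≟ w ⌋ ⟧) (λ w → ⟦ ⌊ d ≟ w ⌋ ⟧))
                                          (cong₂ _+_ (∑-indicator c) (∑-indicator d))) ⟩
    3 ∎
    where
    open ≡-Reasoning
    member : ∀ w → ⟦ inᵇ w ∧ adj G v w ⟧ ≡ ⟦ ⌊ b ≟ w ⌋ ⟧ + (⟦ ⌊ c ≟ w ⌋ ⟧ + ⟦ ⌊ d ≟ w ⌋ ⟧)
    member w with b ≟ w | c ≟ w | d ≟ w
    ... | yes refl | yes refl | _ = ⊥-elim (∼⇒≢ G bc refl)
    ... | yes refl | no _ | yes refl = ⊥-elim (∼⇒≢ G bd refl)
    ... | no _ | yes refl | yes refl = ⊥-elim (∼⇒≢ G cd refl)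
    ... | yes refl | no _ | no _ rewrite inᵇ-true (_ , _ , _ , K₄-swap₁₂ K) | vb = refl
    ... | no _ | yes refl | no _ rewrite inᵇ-true (_ , _ , _ , K₄-swap₁₂ (K₄-swap₂₃ K)) | vc = refl
    ... | no _ | no _ | yes refl rewrite inᵇ-true (_ , _ , _ , K₄-swap₁₂ (K₄-swap₂₃ (K₄-swap₃₄ K))) | vd = refl
    ... | no b≢w | no c≢w | no d≢w with inK₄? G w | adj G v w in vw
    ...   | no _  | _     = refl
    ...   | yes _ | false = refl
    ...   | yes p | true with inK₄-neighbour free K p vw
    ...     | inj₁ e = ⊥-elim (b≢w e)
    ...     | inj₂ (inj₁ e) = ⊥-elim (c≢w e)
    ...     | inj₂ (inj₂ e) = ⊥-elim (d≢w e)

  ∑∑-inner : ∑∑ inner ≡ 3 * covered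
  ∑∑-inner = trans (sum-cong-≗ inner-row) (≡-sym (*-distribˡ-sum 3 (λ v → ⟦ inᵇ v ⟧)))

  -- With every vertex covered, `inner` is the whole adjacency. The left side is even, which rules
  -- this case out for odd `n`.
  allCovered⇒cubic : (∀ v → InK₄ G v) → edges G + edges G ≡ n * 3
  allCovered⇒cubic all = begin
    edges G + edges G       ≡⟨ handshake G ⟨
    ∑∑ (adjℕ G)             ≡⟨ sum-cong-≗ (λ v → sum-cong-≗ (λ w → inner-all v w)) ⟩
    ∑∑ inner                ≡⟨ sum-cong-≗ inner-row ⟩
    ∑[ v < n ] (3 * ⟦ inᵇ v ⟧) ≡⟨ sum-cong-≗ (λ v → cong (λ b → 3 * ⟦ b ⟧) (inᵇ-true (all v))) ⟩
    ∑[ v < n ] 3            ≡⟨ ∑-const n 3 ⟩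
    n * 3                   ∎
    where
    open ≡-Reasoning
    inner-all : ∀ v w → adjℕ G v w ≡ inner v w
    inner-all v w rewrite inᵇ-true (all v) | inᵇ-true (all w) = refl

  module _ (saturated : ∀ u v → (u≢v : u ≢ v) → adj G u v ≡ false → Contains (addEdge G u v u≢v)) where

    completing : ∀ {u v} → u ≢ v → adj G u v ≡ false → Completes G u v
    completing {u} {v} u≢v na = completes G u≢v free (saturated u v u≢v na)

    outer : Fin n → Fin n → ℕ
    outer v w = ⟦ inᵇ v ∧ (not (inᵇ w) ∧ adj G v w) ⟧

    outer-true : ∀ {v w} → InK₄ G v → ¬ InK₄ G w → v ~ w → 1 ≤ sum (outer v)
    outer-true {v} {w} p ¬q vw = ℕ.≤-trans (ℕ.≤-reflexive (≡-sym isOne)) (term≤∑ (outer v) w)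
      where
      isOne : outer v w ≡ 1
      isOne rewrite inᵇ-true p | inᵇ-false ¬q | vw = refl

    -- Joining a vertex of an isolated clique to an uncovered vertex would not complete any forbidden graph.
    exit : ∀ {z} → ¬ InK₄ G z → ∀ {a b c d} → K₄ G a b c d →
           ∃ λ w → ¬ InK₄ G w × (a ~ w ⊎ b ~ w ⊎ c ~ w ⊎ d ~ w)
    exit {z} ¬z {a} {b} {c} {d} K with any? (λ w → ¬? (inK₄? G w) ×-dec
      ((a ∼?⟨ G ⟩ w) ⊎-dec (b ∼?⟨ G ⟩ w) ⊎-dec (c ∼?⟨ G ⟩ w) ⊎-dec (d ∼?⟨ G ⟩ w)))
    ... | yes p = p
    ... | no ¬exit = ⊥-elim (isolated (completing a≢z a≁z))
      where
      a≢z : a ≢ z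
      a≢z refl = ¬z (_ , _ , _ , K)
      a≁z : adj G a z ≡ false
      a≁z = ¬-not (λ az → ¬exit (z , ¬z , inj₁ az))
      -- Each kind of completion not excluded by `¬z` yields a path from `a` through some `x` to
      -- `z`. Either `x` is uncovered and `ax` is an exit, or `x` belongs to the clique and `xz` is
      -- one.
      noPath : ∀ {x} → a ~ x → ¬ z ~ x
      noPath {x} ax zx with inK₄? G x
      ... | no ¬x = ¬exit (x , ¬x , inj₁ ax)
      ... | yes p with inK₄-neighbour free K p ax
      ...   | inj₁ refl = ¬exit (z , ¬z , inj₂ (inj₁ (∼-sym {G = G} zx)))
      ...   | inj₂ (inj₁ refl) = ¬exit (z , ¬z , inj₂ (inj₂ (inj₁ (∼-sym {G = G} zx))))
      ...   | inj₂ (inj₂ refl) = ¬exit (z , ¬z , inj₂ (inj₂ (inj₂ (∼-sym {G = G} zx))))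
      isolated : ¬ Completes G a z
      isolated (common ax _ zx _ _) = noPath ax zx
      isolated (joins _ q)          = ¬z q
      isolated (attachesˡ K′ zx)    = noPath (K₄.ab K′) zx
      isolated (attachesʳ K′ _)     = ¬z (_ , _ , _ , K′)

    exits : Fin n → ℕ
    exits v = sum (outer v)

    -- The factor `inner v w` selects the clique mates of `v`, so for covered `v` the right side
    -- counts the exits of its whole clique, and `exit` supplies one.
    clique-exits : ∀ {z} → ¬ InK₄ G z → ∀ v → ⟦ inᵇ v ⟧ ≤ exits v + ∑[ w < n ] (inner v w * exits w)
    clique-exits ¬z v = by-cases (inK₄? G v)
      where
      via : ∀ {w z} → InK₄ G v → InK₄ G w → v ~ w → ¬ InK₄ G z → w ~ z →
            1 ≤ exits v + ∑[ w < n ] (inner v w * exits w)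
      via {w} {z} p q vw ¬z wz = begin
        1                                         ≤⟨ outer-true q ¬z wz ⟩
        exits w                                   ≡⟨ ℕ.*-identityˡ (exits w) ⟨
        1 * exits w                               ≡⟨ cong (_* exits w) isOne ⟨
        inner v w * exits w                       ≤⟨ term≤∑ (λ w → inner v w * exits w) w ⟩
        ∑[ w < n ] (inner v w * exits w)          ≤⟨ ℕ.m≤n+m _ (exits v) ⟩
        exits v + ∑[ w < n ] (inner v w * exits w) ∎
        where
        open ℕ.≤-Reasoning
        isOne : inner v w ≡ 1
        isOne rewrite inᵇ-true p | inᵇ-true q | vw = refl
      reached : InK₄ G v → 1 ≤ exits v + ∑[ w < n ] (inner v w * exits w)
      reached p@(b , c , d , K) with exit ¬z K
      ... | w , ¬w , inj₁ vw = ℕ.≤-trans (outer-true p ¬w vw) (ℕ.m≤m+n _ _)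
      ... | w , ¬w , inj₂ (inj₁ bw) = via p (_ , _ , _ , K₄-swap₁₂ K) (K₄.ab K) ¬w bw
      ... | w , ¬w , inj₂ (inj₂ (inj₁ cw)) = via p (_ , _ , _ , K₄-swap₁₂ (K₄-swap₂₃ K)) (K₄.ac K) ¬w cw
      ... | w , ¬w , inj₂ (inj₂ (inj₂ dw)) = via p (_ , _ , _ , K₄-swap₁₂ (K₄-swap₂₃ (K₄-swap₃₄ K))) (K₄.ad K) ¬w dw
      by-cases : Dec (InK₄ G v) → ⟦ inᵇ v ⟧ ≤ exits v + ∑[ w < n ] (inner v w * exits w)
      by-cases (no ¬p) = ℕ.≤-trans (ℕ.≤-reflexive (cong ⟦_⟧ (inᵇ-false ¬p))) z≤n
      by-cases (yes p) = ℕ.≤-trans (⟦⟧≤1 (inᵇ v)) (reached p)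

    -- Sum `clique-exits` and exchange the sums: the exits of a vertex are counted once for itself
    -- and at most three times for its clique mates.
    covered≤4exits : ∀ {z} → ¬ InK₄ G z → covered ≤ 4 * ∑∑ outer
    covered≤4exits ¬z = begin
      covered
        ≤⟨ ∑-mono-≤ (clique-exits ¬z) ⟩
      ∑[ v < n ] (exits v + ∑[ w < n ] (inner v w * exits w))
        ≡⟨ ∑-distrib-+ exits (λ v → ∑[ w < n ] (inner v w * exits w)) ⟩
      ∑∑ outer + ∑∑ (λ v w → inner v w * exits w)
        ≡⟨ cong (∑∑ outer +_) (∑-comm (λ v w → inner v w * exits w)) ⟩
      ∑∑ outer + ∑[ w < n ] ∑[ v < n ] (inner v w * exits w)
        ≡⟨ cong (∑∑ outer +_) (sum-cong-≗ (λ w → ≡-sym (*-distribʳ-sum (exits w) (λ v → inner v w)))) ⟩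
      ∑∑ outer + ∑[ w < n ] (∑[ v < n ] inner v w * exits w)
        ≤⟨ ℕ.+-monoʳ-≤ (∑∑ outer) (∑-mono-≤ λ w → ℕ.*-monoˡ-≤ (exits w) (column w)) ⟩
      ∑∑ outer + ∑[ w < n ] (3 * exits w)
        ≡⟨ cong (∑∑ outer +_) (*-distribˡ-sum 3 exits) ⟨
      4 * ∑∑ outer ∎
      where
      open ℕ.≤-Reasoning
      column : ∀ w → ∑[ v < n ] inner v w ≤ 3
      column w = begin
        ∑[ v < n ] inner v w ≡⟨ sum-cong-≗ (λ v → inner-sym v w) ⟩
        ∑[ v < n ] inner w v ≡⟨ inner-row w ⟩
        3 * ⟦ inᵇ w ⟧        ≤⟨ ℕ.*-monoʳ-≤ 3 (⟦⟧≤1 (inᵇ w)) ⟩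
        3                    ∎

    -- In the sum of degrees, `inner`, `outer` and the transpose of `outer` count disjoint sets of
    -- ordered adjacent pairs.
    coveredBound : 3 * covered + (∑∑ outer + ∑∑ outer) ≤ edges G + edges G
    coveredBound = begin
      3 * covered + (∑∑ outer + ∑∑ outer)
        ≡⟨ cong₂ _+_ (≡-sym ∑∑-inner) (cong (∑∑ outer +_) (≡-sym (∑∑-transpose outer))) ⟩
      ∑∑ inner + (∑∑ outer + ∑∑ (λ v w → outer w v))
        ≡⟨ cong (∑∑ inner +_) (∑∑-distrib-+ outer (λ v w → outer w v)) ⟨
      ∑∑ inner + ∑∑ (λ v w → outer v w + outer w v)
        ≡⟨ ∑∑-distrib-+ inner (λ v w → outer v w + outer w v) ⟨
      ∑∑ (λ v w → inner v w + (outer v w + outer w v))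
        ≤⟨ ∑∑-mono-≤ pointwise ⟩
      ∑∑ (adjℕ G)
        ≡⟨ handshake G ⟩
      edges G + edges G ∎
      where
      open ℕ.≤-Reasoning
      pointwise : ∀ v w → inner v w + (outer v w + outer w v) ≤ adjℕ G v w
      pointwise v w rewrite sym G w v with inᵇ v | inᵇ w | adj G v w
      ... | true  | true  | true  = s≤s z≤n
      ... | true  | true  | false = z≤n
      ... | true  | false | true  = s≤s z≤n
      ... | true  | false | false = z≤n
      ... | false | true  | true  = s≤s z≤n
      ... | false | true  | false = z≤n
      ... | false | false | _     = z≤n

    -- Every completion other than `common` would put `u` or `v` in a K₄.
    commonNeighbours : ∀ {u v} → ¬ InK₄ G u → ¬ InK₄ G v → u ≢ v → adj G u v ≡ false →
      2 ≤ ∑[ w < n ] ⟦ adj G u w ∧ adj G v w ⟧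
    commonNeighbours {u} {v} ¬u ¬v u≢v na with completing u≢v na
    ... | joins p _     = ⊥-elim (¬u p)
    ... | attachesˡ K _ = ⊥-elim (¬u (_ , _ , _ , K))
    ... | attachesʳ K _ = ⊥-elim (¬v (_ , _ , _ , K))
    ... | common {x} {y} ux uy vx vy xy = begin
      2                                               ≡⟨ cong₂ _+_ (∑-indicator x) (∑-indicator y) ⟨
      ∑[ w < n ] ⟦ ⌊ x ≟ w ⌋ ⟧ + ∑[ w < n ] ⟦ ⌊ y ≟ w ⌋ ⟧ ≡⟨ ∑-distrib-+ (λ w → ⟦ ⌊ x ≟ w ⌋ ⟧) (λ w → ⟦ ⌊ y ≟ w ⌋ ⟧) ⟨
      ∑[ w < n ] (⟦ ⌊ x ≟ w ⌋ ⟧ + ⟦ ⌊ y ≟ w ⌋ ⟧)        ≤⟨ ∑-mono-≤ pointwise ⟩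
      ∑[ w < n ] ⟦ adj G u w ∧ adj G v w ⟧             ∎
      where
      open ℕ.≤-Reasoning
      pointwise : ∀ w → ⟦ ⌊ x ≟ w ⌋ ⟧ + ⟦ ⌊ y ≟ w ⌋ ⟧ ≤ ⟦ adj G u w ∧ adj G v w ⟧
      pointwise w with x ≟ w | y ≟ w
      ... | yes refl | yes refl = ⊥-elim (∼⇒≢ G xy refl)
      ... | yes refl | no _ rewrite ux | vx = s≤s z≤n
      ... | no _ | yes refl rewrite uy | vy = s≤s z≤n
      ... | no _ | no _ = z≤n

    -- The case of an uncovered vertex of degree at most three

    module _ {u} (¬u : ¬ InK₄ G u) (deg≤3 : degree G u ≤ 3) where

      hub : Fin n → Fin n → ℕ
      hub v w = ⟦ not (inᵇ v) ∧ (adj G u w ∧ adj G v w) ⟧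

      -- An uncovered `v` that is neither `u` nor adjacent to it shares two neighbours with `u`. The
      -- last two terms pay for the exceptions.
      hub-row : ∀ v → 2 * ⟦ not (inᵇ v) ⟧ ≤ sum (hub v) + (2 * ⟦ ⌊ u ≟ v ⌋ ⟧ + 2 * adjℕ G u v)
      hub-row v with inK₄? G v | u ≟ v | adj G u v in uv
      ... | yes _ | _     | _     = z≤n
      ... | no _  | yes _ | _     = ℕ.≤-trans (ℕ.m≤m+n 2 _) (ℕ.m≤n+m _ _)
      ... | no _  | no _  | true  = ℕ.m≤n+m 2 _
      ... | no ¬v | no u≢v | false = ℕ.≤-trans (commonNeighbours ¬u ¬v u≢v uv) (ℕ.m≤m+n _ _)

      -- The exceptions are `u` and its at most three neighbours, at a cost of 2 each, hence 8.
      2uncovered≤hub : 2 * uncovered ≤ ∑∑ hub + 8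
      2uncovered≤hub = begin
        2 * uncovered
          ≡⟨ *-distribˡ-sum 2 (λ v → ⟦ not (inᵇ v) ⟧) ⟩
        ∑[ v < n ] (2 * ⟦ not (inᵇ v) ⟧)
          ≤⟨ ∑-mono-≤ hub-row ⟩
        ∑[ v < n ] (sum (hub v) + (2 * ⟦ ⌊ u ≟ v ⌋ ⟧ + 2 * adjℕ G u v))
          ≡⟨ ∑-distrib-+ (λ v → sum (hub v)) (λ v → 2 * ⟦ ⌊ u ≟ v ⌋ ⟧ + 2 * adjℕ G u v) ⟩
        ∑∑ hub + ∑[ v < n ] (2 * ⟦ ⌊ u ≟ v ⌋ ⟧ + 2 * adjℕ G u v)
          ≡⟨ cong (∑∑ hub +_) (∑-distrib-+ (λ v → 2 * ⟦ ⌊ u ≟ v ⌋ ⟧) (λ v → 2 * adjℕ G u v)) ⟩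
        ∑∑ hub + (∑[ v < n ] (2 * ⟦ ⌊ u ≟ v ⌋ ⟧) + ∑[ v < n ] (2 * adjℕ G u v))
          ≡⟨ cong (∑∑ hub +_) (cong₂ _+_ (*-distribˡ-sum 2 (λ v → ⟦ ⌊ u ≟ v ⌋ ⟧)) (*-distribˡ-sum 2 (adjℕ G u))) ⟨
        ∑∑ hub + (2 * ∑[ v < n ] ⟦ ⌊ u ≟ v ⌋ ⟧ + 2 * degree G u)
          ≤⟨ ℕ.+-monoʳ-≤ (∑∑ hub) (ℕ.+-mono-≤ (ℕ.≤-reflexive (cong (2 *_) (∑-indicator u))) (ℕ.*-monoʳ-≤ 2 deg≤3)) ⟩
        ∑∑ hub + 8 ∎
        where open ℕ.≤-Reasoning

      -- Corrects for edges between two neighbours of `u`, which `hub` can count from either end.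
      both : Fin n → Fin n → ℕ
      both v w = adjℕ G u v * adjℕ G u w

      ∑∑-both : ∑∑ both ≤ 9
      ∑∑-both = begin
        ∑∑ both                                 ≡⟨ sum-cong-≗ (λ v → *-distribˡ-sum (adjℕ G u v) (adjℕ G u)) ⟨
        ∑[ v < n ] (adjℕ G u v * degree G u)    ≡⟨ *-distribʳ-sum (degree G u) (adjℕ G u) ⟨
        degree G u * degree G u                 ≤⟨ ℕ.*-mono-≤ deg≤3 deg≤3 ⟩
        9                                       ∎
        where open ℕ.≤-Reasoning

      -- As in `coveredBound`, except that `hub` and its transpose may overlap. An overlap needs
      -- both ends adjacent to `u`, and there are at most 9 such ordered pairs.
      hubBound : 3 * covered + (∑∑ hub + ∑∑ hub) ≤ edges G + edges G + 9
      hubBound = begin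
        3 * covered + (∑∑ hub + ∑∑ hub)
          ≡⟨ cong₂ _+_ (≡-sym ∑∑-inner) (cong (∑∑ hub +_) (≡-sym (∑∑-transpose hub))) ⟩
        ∑∑ inner + (∑∑ hub + ∑∑ (λ v w → hub w v))
          ≡⟨ cong (∑∑ inner +_) (∑∑-distrib-+ hub (λ v w → hub w v)) ⟨
        ∑∑ inner + ∑∑ (λ v w → hub v w + hub w v)
          ≡⟨ ∑∑-distrib-+ inner (λ v w → hub v w + hub w v) ⟨
        ∑∑ (λ v w → inner v w + (hub v w + hub w v))
          ≤⟨ ∑∑-mono-≤ pointwise ⟩
        ∑∑ (λ v w → adjℕ G v w + both v w)
          ≡⟨ ∑∑-distrib-+ (adjℕ G) both ⟩
        ∑∑ (adjℕ G) + ∑∑ both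
          ≤⟨ ℕ.+-mono-≤ (ℕ.≤-reflexive (handshake G)) ∑∑-both ⟩
        edges G + edges G + 9 ∎
        where
        open ℕ.≤-Reasoning
        pointwise : ∀ v w → inner v w + (hub v w + hub w v) ≤ adjℕ G v w + both v w
        pointwise v w rewrite sym G w v with inᵇ v | inᵇ w | adj G v w | adj G u v | adj G u w
        ... | true  | true  | true  | _     | _     = s≤s z≤n
        ... | true  | true  | false | _     | _     = z≤n
        ... | true  | false | true  | true  | _     = s≤s z≤n
        ... | true  | false | true  | false | _     = z≤n
        ... | true  | false | false | true  | _     = z≤n
        ... | true  | false | false | false | _     = z≤n
        ... | false | true  | true  | _     | true  = s≤s z≤n
        ... | false | true  | true  | _     | false = z≤n
        ... | false | true  | false | _     | true  = z≤n
        ... | false | true  | false | _     | false = z≤n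
        ... | false | false | true  | true  | true  = s≤s (s≤s z≤n)
        ... | false | false | true  | true  | false = s≤s z≤n
        ... | false | false | true  | false | true  = s≤s z≤n
        ... | false | false | true  | false | false = z≤n
        ... | false | false | false | true  | true  = z≤n
        ... | false | false | false | true  | false = z≤n
        ... | false | false | false | false | true  = z≤n
        ... | false | false | false | false | false = z≤n

      -- Using `2uncovered≤hub` twice costs 16, and `hubBound` costs 9 more.
      lowDegreeBound : 3 * covered + 4 * uncovered ≤ edges G + edges G + 25
      lowDegreeBound = begin
        3 * covered + 4 * uncovered                       ≡⟨ cong (3 * covered +_) (four uncovered) ⟩
        3 * covered + (2 * uncovered + 2 * uncovered)     ≤⟨ ℕ.+-monoʳ-≤ (3 * covered) (ℕ.+-mono-≤ 2uncovered≤hub 2uncovered≤hub) ⟩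
        3 * covered + (∑∑ hub + 8 + (∑∑ hub + 8))         ≡⟨ regroup (3 * covered) (∑∑ hub) ⟩
        3 * covered + (∑∑ hub + ∑∑ hub) + 16              ≤⟨ ℕ.+-monoˡ-≤ 16 hubBound ⟩
        edges G + edges G + 9 + 16                        ≡⟨ ℕ.+-assoc (edges G + edges G) 9 16 ⟩
        edges G + edges G + 25                            ∎
        where
        open ℕ.≤-Reasoning
        four : ∀ x → 4 * x ≡ 2 * x + 2 * x
        four = solve-∀
        regroup : ∀ x y → x + (y + 8 + (y + 8)) ≡ x + (y + y) + 16
        regroup = solve-∀

    -- Sum the degrees: a covered vertex already has three neighbours in its clique, by `inner-row`.
    highDegreeBound : (∀ v → ¬ InK₄ G v → 4 ≤ degree G v) → 3 * covered + 4 * uncovered ≤ edges G + edges G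
    highDegreeBound high = begin
      3 * covered + 4 * uncovered
        ≡⟨ cong₂ _+_ (*-distribˡ-sum 3 (λ v → ⟦ inᵇ v ⟧)) (*-distribˡ-sum 4 (λ v → ⟦ not (inᵇ v) ⟧)) ⟩
      ∑[ v < n ] (3 * ⟦ inᵇ v ⟧) + ∑[ v < n ] (4 * ⟦ not (inᵇ v) ⟧)
        ≡⟨ ∑-distrib-+ (λ v → 3 * ⟦ inᵇ v ⟧) (λ v → 4 * ⟦ not (inᵇ v) ⟧) ⟨
      ∑[ v < n ] (3 * ⟦ inᵇ v ⟧ + 4 * ⟦ not (inᵇ v) ⟧)
        ≤⟨ ∑-mono-≤ row ⟩
      sum (degree G)
        ≡⟨ handshake G ⟩
      edges G + edges G ∎
      where
      open ℕ.≤-Reasoning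
      inner≤adj : ∀ v w → inner v w ≤ adjℕ G v w
      inner≤adj v w with inᵇ v | inᵇ w | adj G v w
      ... | true  | true  | true  = s≤s z≤n
      ... | true  | true  | false = z≤n
      ... | true  | false | _     = z≤n
      ... | false | _     | _     = z≤n
      row : ∀ v → 3 * ⟦ inᵇ v ⟧ + 4 * ⟦ not (inᵇ v) ⟧ ≤ degree G v
      row v = by-cases (inK₄? G v)
        where
        by-cases : Dec (InK₄ G v) → 3 * ⟦ inᵇ v ⟧ + 4 * ⟦ not (inᵇ v) ⟧ ≤ degree G v
        by-cases (no ¬p) rewrite inᵇ-false ¬p = high v ¬p
        by-cases (yes p) = begin
          3 * ⟦ inᵇ v ⟧ + 4 * ⟦ not (inᵇ v) ⟧ ≡⟨ cong (λ b → 3 * ⟦ inᵇ v ⟧ + 4 * ⟦ not b ⟧) (inᵇ-true p) ⟩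
          3 * ⟦ inᵇ v ⟧ + 0                   ≡⟨ ℕ.+-identityʳ _ ⟩
          3 * ⟦ inᵇ v ⟧                       ≡⟨ inner-row v ⟨
          ∑[ w < n ] inner v w                ≤⟨ ∑-mono-≤ (inner≤adj v) ⟩
          degree G v                          ∎

    degreeBound : 3 * covered + 4 * uncovered ≤ edges G + edges G + 25
    degreeBound with any? (λ u → ¬? (inK₄? G u) ×-dec (degree G u ℕ.≤? 3))
    ... | yes (u , ¬u , deg≤3) = lowDegreeBound ¬u deg≤3
    ... | no none = ℕ.≤-trans (highDegreeBound λ v ¬v → ℕ.≰⇒> (λ deg≤3 → none (v , ¬v , deg≤3))) (ℕ.m≤m+n _ 25)

    -- `coveredBound` with `covered≤4exits` gives 7/2 per covered vertex in the degree sum, while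
    -- `degreeBound` gives 3 per covered and 4 per uncovered vertex. The weights 2 and 7 bring both
    -- kinds of vertex to 28, and 175 is 7 times 25.
    edgeBound : ∀ {z} → ¬ InK₄ G z → 28 * n ≤ 18 * edges G + 175
    edgeBound ¬z = begin
      28 * n                                              ≡⟨ cong (28 *_) covered+uncovered ⟨
      28 * (covered + uncovered)                          ≡⟨ split covered uncovered ⟩
      6 * covered + covered + 7 * (3 * covered + 4 * uncovered)
        ≤⟨ ℕ.+-monoˡ-≤ _ (ℕ.+-monoʳ-≤ (6 * covered) (covered≤4exits ¬z)) ⟩
      6 * covered + 4 * ∑∑ outer + 7 * (3 * covered + 4 * uncovered)
        ≡⟨ cong (_+ 7 * (3 * covered + 4 * uncovered)) (double covered (∑∑ outer)) ⟩
      2 * (3 * covered + (∑∑ outer + ∑∑ outer)) + 7 * (3 * covered + 4 * uncovered)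
        ≤⟨ ℕ.+-mono-≤ (ℕ.*-monoʳ-≤ 2 coveredBound) (ℕ.*-monoʳ-≤ 7 degreeBound) ⟩
      2 * (edges G + edges G) + 7 * (edges G + edges G + 25)
        ≡⟨ collect (edges G) ⟩
      18 * edges G + 175 ∎
      where
      open ℕ.≤-Reasoning
      split : ∀ x y → 28 * (x + y) ≡ 6 * x + x + 7 * (3 * x + 4 * y)
      split = solve-∀
      double : ∀ x y → 6 * x + 4 * y ≡ 2 * (3 * x + (y + y))
      double = solve-∀
      collect : ∀ x → 2 * (x + x) + 7 * (x + x + 25) ≡ 18 * x + 175
      collect = solve-∀

-- If every vertex were covered, the degree sum would be three times an odd order, but it is twice
-- the number of edges.
lowerBound : ∀ k m (G : Graph (1 + 4 * m)) → k + 8 ≤ 1 + 4 * m → Saturated (family k) G →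
  28 * (1 + 4 * m) ≤ 18 * edges G + 175
lowerBound k m G size (free , add) = edgeBound G free′ add′ (proj₂ uncoveredVertex)
  where
  free′ : ¬ Contains G
  free′ c = free (contains⇒member k {G} size c)
  add′ : ∀ u v → (u≢v : u ≢ v) → adj G u v ≡ false → Contains (addEdge G u v u≢v)
  add′ u v u≢v na = member⇒contains k {addEdge G u v u≢v} (add u v u≢v na)
  even≢odd : ∀ x y → x + x ≢ 1 + (y + y)
  even≢odd (suc x) zero e = ℕ.m+1+n≢0 x (ℕ.suc-injective e)
  even≢odd (suc x) (suc y) e = even≢odd x y (ℕ.suc-injective (ℕ.suc-injective
    (trans (cong suc (≡-sym (ℕ.+-suc x x))) (trans e (cong (2 +_) (ℕ.+-suc y y))))))
  odd : ∀ m → (1 + 4 * m) * 3 ≡ 1 + ((1 + 6 * m) + (1 + 6 * m))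
  odd = solve-∀
  uncoveredVertex : ∃ λ z → ¬ InK₄ G z
  uncoveredVertex = ¬∀⟶∃¬ _ _ (inK₄? G) λ all →
    even≢odd (edges G) (1 + 6 * m) (trans (allCovered⇒cubic G free′ all) (odd m))

-- Disjoint cliques

disjointCliques : ∀ m → Graph (m * 4)
disjointCliques m = symmetrise λ u v → ⌊ quotient {m} 4 u ≟ quotient 4 v ⌋

-- A block is four consecutive indices, so the four leading terms all equal `g 0F`.
∑-block : ∀ {m} (g : Fin m → ℕ) → ∑[ v < m * 4 ] g (quotient 4 v) ≡ 4 * sum g
∑-block {zero}  g = refl
∑-block {suc m} g = trans (cong (λ s → g 0F + (g 0F + (g 0F + (g 0F + s)))) (∑-block (g ∘ suc)))
                          (regroup (g 0F) (sum (g ∘ suc)))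
  where
  regroup : ∀ x s → x + (x + (x + (x + 4 * s))) ≡ 4 * (x + s)
  regroup = solve-∀

-- In each forbidden graph vertex `0F` is adjacent to `1F` through `4F`, so a cubic graph contains
-- none of them. The shift `↑ˡ` restricts a copy to its first five vertices.
contains⇒star : ∀ {n} {G : Graph n} → Contains G →
  ∃ λ (g : Fin 5 → Fin n) → Injective _≡_ _≡_ g × (∀ i → g 0F ∼⟨ G ⟩ g (suc i))
contains⇒star (attached (f , inj , hom)) = f , inj ,
  λ { 0F → hom 0F 1F refl ; 1F → hom 0F 2F refl ; 2F → hom 0F 3F refl ; 3F → hom 0F 4F refl }
contains⇒star (shared (f , inj , hom)) = f ∘ (_↑ˡ 2) , ↑ˡ-injective 2 _ _ ∘ inj ,
  λ { 0F → hom 0F 1F refl ; 1F → hom 0F 2F refl ; 2F → hom 0F 3F refl ; 3F → hom 0F 4F refl }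
contains⇒star (joined (f , inj , hom)) = f ∘ (_↑ˡ 3) , ↑ˡ-injective 3 _ _ ∘ inj ,
  λ { 0F → hom 0F 1F refl ; 1F → hom 0F 2F refl ; 2F → hom 0F 3F refl ; 3F → hom 0F 4F refl }

module _ (m : ℕ) where

  private
    G = disjointCliques m
    block : Fin (m * 4) → Fin m
    block = quotient 4

  sameBlock⁺ : ∀ {u v} → u ≢ v → block u ≡ block v → u ∼⟨ G ⟩ v
  sameBlock⁺ {u} {v} u≢v e with u ≟ v | block u ≟ block v
  ... | yes p | _     = ⊥-elim (u≢v p)
  ... | no _  | yes _ = refl
  ... | no _  | no ¬e = ⊥-elim (¬e e)

  sameBlock⁻ : ∀ {u v} → u ∼⟨ G ⟩ v → block u ≡ block v
  sameBlock⁻ {u} {v} e with u ≟ v | block u ≟ block v | block v ≟ block u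
  sameBlock⁻ () | yes _ | _ | _
  ... | no _ | yes p | _     = p
  ... | no _ | no _  | yes p = ≡-sym p
  sameBlock⁻ () | no _ | no _ | no _

  -- Counting `u` itself alongside its neighbours gives its whole block.
  disjointCliques-degree : ∀ u → degree G u + 1 ≡ 4
  disjointCliques-degree u = begin
    degree G u + 1                                              ≡⟨ cong (degree G u +_) (∑-indicator u) ⟨
    degree G u + ∑[ v < m * 4 ] ⟦ ⌊ u ≟ v ⌋ ⟧                   ≡⟨ ∑-distrib-+ (adjℕ G u) (λ v → ⟦ ⌊ u ≟ v ⌋ ⟧) ⟨
    ∑[ v < m * 4 ] (adjℕ G u v + ⟦ ⌊ u ≟ v ⌋ ⟧)                 ≡⟨ sum-cong-≗ pointwise ⟩
    ∑[ v < m * 4 ] ⟦ ⌊ block u ≟ block v ⌋ ⟧                    ≡⟨ ∑-block (λ b → ⟦ ⌊ block u ≟ b ⌋ ⟧) ⟩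
    4 * ∑[ b < m ] ⟦ ⌊ block u ≟ b ⌋ ⟧                          ≡⟨ cong (4 *_) (∑-indicator (block u)) ⟩
    4                                                           ∎
    where
    open ≡-Reasoning
    pointwise : ∀ v → adjℕ G u v + ⟦ ⌊ u ≟ v ⌋ ⟧ ≡ ⟦ ⌊ block u ≟ block v ⌋ ⟧
    pointwise v with u ≟ v | block u ≟ block v | block v ≟ block u
    ... | yes _    | yes _ | _     = refl
    ... | yes refl | no ¬e | _     = ⊥-elim (¬e refl)
    ... | no _     | yes _ | _     = refl
    ... | no _     | no ¬e | yes e = ⊥-elim (¬e (≡-sym e))
    ... | no _     | no _  | no _  = refl

  disjointCliques-edges : edges G ≡ 6 * m
  disjointCliques-edges = ℕ.*-cancelˡ-≡ (edges G) (6 * m) 2 (begin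
    2 * edges G          ≡⟨ cong (edges G +_) (ℕ.+-identityʳ (edges G)) ⟩
    edges G + edges G    ≡⟨ handshake G ⟨
    sum (degree G)       ≡⟨ sum-cong-≗ (λ u → ℕ.+-cancelʳ-≡ 1 (degree G u) 3 (disjointCliques-degree u)) ⟩
    ∑[ u < m * 4 ] 3     ≡⟨ ∑-const (m * 4) 3 ⟩
    m * 4 * 3            ≡⟨ regroup m ⟩
    2 * (6 * m)          ∎)
    where
    open ≡-Reasoning
    regroup : ∀ m → m * 4 * 3 ≡ 2 * (6 * m)
    regroup = solve-∀

  -- The five vertices of a star would lie in one block. Two of them then agree in remainder as
  -- well, and so coincide.
  disjointCliques-free : ¬ Contains G
  disjointCliques-free c with contains⇒star {G = G} c
  ... | g , inj , star with pigeonhole ℕ.≤-refl (remainder {m} 4 ∘ g)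
  ...   | i , j , i<j , same = <⇒≢ i<j (inj (begin
    g i                                              ≡⟨ combine-remQuot {m} 4 (g i) ⟨
    combine (block (g i)) (remainder {m} 4 (g i))    ≡⟨ cong₂ combine (trans (centre i) (≡-sym (centre j))) same ⟩
    combine (block (g j)) (remainder {m} 4 (g j))    ≡⟨ combine-remQuot {m} 4 (g j) ⟩
    g j                                              ∎))
    where
    open ≡-Reasoning
    centre : ∀ i → block (g i) ≡ block (g 0F)
    centre zero    = refl
    centre (suc i) = ≡-sym (sameBlock⁻ (star i))

  disjointCliques-inK₄ : ∀ u → InK₄ G u
  disjointCliques-inK₄ u = subst (InK₄ G) (combine-remQuot {m} 4 u) (at (remainder {m} 4 u))
    where
    v : Fin 4 → Fin (m * 4)
    v i = combine (block u) i
    edge : ∀ {i j} → i ≢ j → v i ∼⟨ G ⟩ v j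
    edge {i} {j} i≢j = sameBlock⁺ (i≢j ∘ combine-injectiveʳ (block u) i (block u) j)
      (trans (cong proj₁ (remQuot-combine (block u) i)) (≡-sym (cong proj₁ (remQuot-combine (block u) j))))
    at : ∀ i → InK₄ G (v i)
    at 0F = v 1F , v 2F , v 3F , k₄ (edge λ ()) (edge λ ()) (edge λ ()) (edge λ ()) (edge λ ()) (edge λ ())
    at 1F = v 0F , v 2F , v 3F , k₄ (edge λ ()) (edge λ ()) (edge λ ()) (edge λ ()) (edge λ ()) (edge λ ())
    at 2F = v 0F , v 1F , v 3F , k₄ (edge λ ()) (edge λ ()) (edge λ ()) (edge λ ()) (edge λ ()) (edge λ ())
    at 3F = v 0F , v 1F , v 2F , k₄ (edge λ ()) (edge λ ()) (edge λ ()) (edge λ ()) (edge λ ()) (edge λ ())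

  -- Distinct non-adjacent vertices lie in different blocks, so the new edge is the bridge of a
  -- `barbell` on these two blocks.
  disjointCliques-completes : ∀ u v (u≢v : u ≢ v) → adj G u v ≡ false → Contains (addEdge G u v u≢v)
  disjointCliques-completes u v u≢v na with disjointCliques-inK₄ u | disjointCliques-inK₄ v
  ... | b , c , d , K@(k₄ ub uc ud _ _ _) | f , g , h , K′@(k₄ vf vg vh _ _ _) = joined
    (barbell-copy {G = addEdge G u v u≢v} (keep K) (keep K′) (addEdge-new G u≢v)
      (off refl) (off (sameBlock⁻ vf)) (off (sameBlock⁻ vg)) (off (sameBlock⁻ vh)))
    where
    keep : ∀ {a b c d} → K₄ G a b c d → K₄ (addEdge G u v u≢v) a b c d
    keep (k₄ ab ac ad bc bd cd) = k₄ (old ab) (old ac) (old ad) (old bc) (old bd) (old cd)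
      where
      old : ∀ {x y} → x ∼⟨ G ⟩ y → x ∼⟨ addEdge G u v u≢v ⟩ y
      old = ⊆-addEdge G u≢v _ _
    -- A vertex common to both blocks would make `u` and `v` adjacent.
    apart : ∀ {x y} → block u ≡ block x → block v ≡ block y → x ≢ y
    apart p q refl with trans (≡-sym (sameBlock⁺ u≢v (trans p (≡-sym q)))) na
    ... | ()
    off : ∀ {y} → block v ≡ block y → Off u b c d y
    off q = apart refl q , apart (sameBlock⁻ ub) q , apart (sameBlock⁻ uc) q , apart (sameBlock⁻ ud) q

  disjointCliques-saturated : ∀ k → k + 8 ≤ m * 4 → Saturated (family k) G
  disjointCliques-saturated k size = (λ c → disjointCliques-free (member⇒contains k {G} c)) ,
    λ u v u≢v na → contains⇒member k {addEdge G u v u≢v} size (disjointCliques-completes u v u≢v na)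

-- Comparison of ratios and divergence

/-≤ : ∀ a b c d → a * suc d ≤ c * suc b → (ℤ.+ a) ℚ./ suc b ℚ.≤ (ℤ.+ c) ℚ./ suc d
/-≤ a b c d le = ℚ.toℚᵘ-cancel-≤ (begin
  ℚ.toℚᵘ (ℚ.fromℚᵘ (mkℚᵘ (ℤ.+ a) b)) ≃⟨ ℚ.toℚᵘ-fromℚᵘ (mkℚᵘ (ℤ.+ a) b) ⟩
  mkℚᵘ (ℤ.+ a) b                     ≤⟨ *≤* (subst₂ ℤ._≤_ (ℤ.pos-* a (suc d)) (ℤ.pos-* c (suc b)) (ℤ.+≤+ le)) ⟩
  mkℚᵘ (ℤ.+ c) d                     ≃⟨ ℚ.toℚᵘ-fromℚᵘ (mkℚᵘ (ℤ.+ c) d) ⟨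
  ℚ.toℚᵘ (ℚ.fromℚᵘ (mkℚᵘ (ℤ.+ c) d)) ∎)
  where open ℚᵘ.≤-Reasoning

-- The threshold 55/36 lies between 3/2 = 54/36, for orders divisible by 4, and 14/9 = 56/36, the
-- leading coefficient of the lower bound.
gap : ∀ {p q} → (ℤ.+ 55) ℚ./ 36 ℚ.≤ p → q ℚ.≤ (ℤ.+ 3) ℚ./ 2 → (ℤ.+ 1) ℚ./ 36 ℚ.≤ ℚ.∣ p ℚ.- q ∣
gap {p} {q} 55/36≤p q≤3/2 = begin
  (ℤ.+ 1) ℚ./ 36                     ≡⟨⟩
  (ℤ.+ 55) ℚ./ 36 ℚ.- (ℤ.+ 3) ℚ./ 2    ≤⟨ ℚ.+-mono-≤ 55/36≤p (ℚ.neg-antimono-≤ q≤3/2) ⟩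
  p ℚ.- q                          ≤⟨ p≤∣p∣ (p ℚ.- q) ⟩
  ℚ.∣ p ℚ.- q ∣                    ∎
  where
  open ℚ.≤-Reasoning
  p≤∣p∣ : ∀ p → p ℚ.≤ ℚ.∣ p ∣
  p≤∣p∣ p with ℚ.≤-total 0ℚ p
  ... | inj₁ 0≤p = ℚ.≤-reflexive (≡-sym (ℚ.0≤p⇒∣p∣≡p 0≤p))
  ... | inj₂ p≤0 = ℚ.≤-trans p≤0 (ℚ.0≤∣p∣ p)

module _ (k : ℕ) (s : ℕ → ℕ) (isSat : ∀ n → IsSat n (family k) (s n)) where

  -- Since `ratio` starts at order 1, the index `3 + m * 4` stands for order `suc m * 4`, where the
  -- disjoint cliques bound the saturation number.
  divisibleRatio : ∀ m → k + 8 ≤ suc m * 4 → ratio s (3 + m * 4) ℚ.≤ (ℤ.+ 3) ℚ./ 2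
  divisibleRatio m size = /-≤ (s (suc m * 4)) (3 + m * 4) 3 1 (begin
    s (suc m * 4) * 2                        ≤⟨ ℕ.*-monoˡ-≤ 2 (proj₂ (isSat (suc m * 4)) (disjointCliques (suc m)) (disjointCliques-saturated (suc m) k size)) ⟩
    edges (disjointCliques (suc m)) * 2      ≡⟨ cong (_* 2) (disjointCliques-edges (suc m)) ⟩
    6 * suc m * 2                            ≡⟨ regroup m ⟩
    3 * (suc m * 4)                          ∎)
    where
    open ℕ.≤-Reasoning
    regroup : ∀ m → 6 * suc m * 2 ≡ 3 * (suc m * 4)
    regroup = solve-∀

  -- Doubling `lowerBound` gives coefficient 56 and the constant 350. Lowering the coefficient to 55
  -- frees one copy of the order, which absorbs that constant.
  oddRatio : ∀ m → k + 8 ≤ 1 + 4 * m → 350 ≤ 1 + 4 * m → (ℤ.+ 55) ℚ./ 36 ℚ.≤ ratio s (4 * m)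
  oddRatio m size large with proj₁ (isSat (1 + 4 * m))
  ... | G , sat , edges≡s = /-≤ 55 35 (s (1 + 4 * m)) (4 * m) (ℕ.+-cancelʳ-≤ 350 _ _ (begin
    55 * (1 + 4 * m) + 350                   ≤⟨ ℕ.+-monoʳ-≤ (55 * (1 + 4 * m)) large ⟩
    55 * (1 + 4 * m) + (1 + 4 * m)           ≡⟨ regroup (1 + 4 * m) ⟩
    2 * (28 * (1 + 4 * m))                   ≤⟨ ℕ.*-monoʳ-≤ 2 (lowerBound k m G size sat) ⟩
    2 * (18 * edges G + 175)                 ≡⟨ cong (λ e → 2 * (18 * e + 175)) edges≡s ⟩
    2 * (18 * s (1 + 4 * m) + 175)           ≡⟨ expand (s (1 + 4 * m)) ⟩
    s (1 + 4 * m) * 36 + 350                 ∎))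
    where
    open ℕ.≤-Reasoning
    regroup : ∀ x → 55 * x + x ≡ 2 * (28 * x)
    regroup = solve-∀
    expand : ∀ x → 2 * (18 * x + 175) ≡ x * 36 + 350
    expand = solve-∀

  -- The orders `1 + 4 * m` and `4 + 4 * m` have ratios at least 1/36 apart for arbitrarily large
  -- `m`, against the Cauchy property.
  diverges : ¬ Converges (ratio s)
  diverges converges with converges ((ℤ.+ 1) ℚ./ 36) (from-yes (0ℚ ℚ.<? (ℤ.+ 1) ℚ./ 36))
  ... | N , close = ℚ.<-irrefl refl (ℚ.<-≤-trans (close (4 * m) (3 + m * 4) N≤4m (ℕ.≤-trans N≤4m (ℕ.≤-trans (ℕ.≤-reflexive (ℕ.*-comm 4 m)) (ℕ.m≤n+m (m * 4) 3))))
    (gap (oddRatio m (ℕ.m≤n⇒m≤1+n size) large) (divisibleRatio m size′)))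
    where
    -- `N` puts both indices past the Cauchy threshold, `k` makes room for the padding, and 88 is
    -- the least number with 350 ≤ 1 + 4 * 88.
    m = N + k + 88
    N≤m : N ≤ m
    N≤m = ℕ.≤-trans (ℕ.m≤m+n N k) (ℕ.m≤m+n (N + k) 88)
    m≤4m : m ≤ 4 * m
    m≤4m = ℕ.m≤n*m m 4
    N≤4m : N ≤ 4 * m
    N≤4m = ℕ.≤-trans N≤m m≤4m
    size : k + 8 ≤ 4 * m
    size = ℕ.≤-trans (ℕ.+-mono-≤ (ℕ.m≤n+m k N) (from-yes (8 ℕ.≤? 88))) m≤4m
    size′ : k + 8 ≤ suc m * 4
    size′ = ℕ.≤-trans size (ℕ.≤-trans (ℕ.≤-reflexive (ℕ.*-comm 4 m)) (ℕ.m≤n+m (m * 4) 4))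
    large : 350 ≤ 1 + 4 * m
    large = ℕ.≤-trans (from-yes (350 ℕ.≤? 1 + 4 * 88)) (s≤s (ℕ.*-monoʳ-≤ 4 (ℕ.m≤n+m 88 (N + k))))

theorem1p8 : Σ (ℕ → Family3) λ Fam →
    (∀ k l → k ≢ l → ¬ SameFamily (Fam k) (Fam l)) ×
    (∀ k → IsFamilyOfSize3 (Fam k) ×
    ∃[ s ] ((∀ n → IsSat n (Fam k) (s n)) × ¬ Converges (ratio s)))
theorem1p8 = family , families-distinct , λ k →
  let isSat = λ n → proj₂ (satNumber (family k) (family-hasEdge k) n)
  in family-size3 k , (λ n → proj₁ (satNumber (family k) (family-hasEdge k) n)) , isSat , diverges k _ isSat
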